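{- Let $(\mathbf A_n)_{n\in\mathbb N}$ be a sequence of base structures and $(\mathbf G_n)_{n\in\mathbb N}$ an elementarily convergent sequence of gadgets. Let $\sigma$ be the equivalence on $\{1,\dots,\mathrm{ar}(R)\}$ given by $(i,j)\in\sigma\iff\lim_{n\to\infty}\mathrm{dist}_{\mathbf G_n}(z_i^{\mathbf G_n},z_j^{\mathbf G_n})<\infty$. If the sequence $(\mathbf A_n^\sigma)_n$ of fragmented base structures is elementarily convergent, then the sequence $(\mathbf A_n*\mathbf G_n)_n$ is elementarily convergent and \[ \operatorname{el-lim}(\mathbf A_n*\mathbf G_n)\equiv(\operatorname{el-lim}\mathbf A_n^\sigma)*_\sigma(\operatorname{el-lim}\mathbf G_n), \] where $\operatorname{el-lim}$ denotes any choice of an elementary limit and $\equiv$ is elementary equivalence.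
   Context: Fix a finite purely relational first-order language $L$ (with equality, positive arities) and a relation symbol $R\notin L$ of arity $\mathrm{ar}(R)\ge 1$. Structures are nonempty and of arbitrary cardinality; $V(\mathbf A)$ is the universe of $\mathbf A$. $\mathrm{dist}_{\mathbf A}$ is the distance in the Gaifman graph of $\mathbf A$ ($+\infty$ for unreachable pairs), and connected components are those of the Gaifman graph. Base structures and gadgets. $L_R=L\cup\{R\}$; a base structure is an $L_R$-structure. $L_G$ is $L$ extended by constants $z_1,\dots,z_{\mathrm{ar}(R)}$; a gadget is an $L_G$-structure $\mathbf G$ in which the vertices $z_i^{\mathbf G}$ (the roots) are pairwise distinct. Gadget construction. $\mathbf A*\mathbf G$ is the $L$-structure with universe $\big(V(\mathbf A)\sqcup(R^{\mathbf A}\times V(\mathbf G))\big)/\!\sim$, where $\sim$ is generated by $e_i\sim(\boldsymbol e,z_i^{\mathbf G})$ for $\boldsymbol e\in R^{\mathbf A}$, $1\le i\le\mathrm{ar}(R)$. For $S\in L$ of arity $s$, $S^{\mathbf A*\mathbf G}=\{([a_1],\dots,[a_s]):(a_1,\dots,a_s)\in S^{\mathbf A}\}\cup\{([(\boldsymbol e,v_1)],\dots,[(\boldsymbol e,v_s)]):\boldsymbol e\in R^{\mathbf A},(v_1,\dots,v_s)\in S^{\mathbf G}\}$. The same construction is used with any other purely relational language in place of $L$ and any other relation symbol in place of $R$. Elementary convergence. A sequence of structures in a fixed language is elementarily convergent if for every sentence $\phi$ either all but finitely many members satisfy $\phi$, or all but finitely many satisfy $\neg\phi$. An elementary limit of it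 is any structure $\mathbf M$ in the same language such that $\mathbf M\models\phi$ iff all but finitely many members satisfy $\phi$, for every sentence $\phi$; it exists and is unique up to elementary equivalence. For an elementarily convergent sequence of gadgets the limits of distances of roots exist in $[0,\infty]$, and $(i,j)\in\sigma$ iff $z_i,z_j$ lie in the same connected component of $\operatorname{el-lim}\mathbf G_n$. Fragmentation. Let $X_1,\dots,X_\ell$ be the classes of $\sigma$ and put $X_0=\emptyset$. $L_\sigma$ is $L$ extended by relation symbols $R_0,\dots,R_\ell$, with $R_i$ of arity $|X_i|+1$. $\mathrm{Gad}(\sigma)$ is the gadget in language $L_\sigma$ plus constants $z_1,\dots,z_{\mathrm{ar}(R)}$, with vertex set $\{z_1,\dots,z_{\mathrm{ar}(R)}\}\cup\{x_0,\dots,x_\ell\}$ (all distinct, roots $z_j$), whose only edges are, for each $i\in\{0,\dots,\ell\}$, one $R_i$-edge consisting of the vertices $z_j$, $j\in X_i$ (in increasing order of $j$), followed by $x_i$. For a base structure $\mathbf A$, $\mathbf A^\sigma=\mathbf A*\mathrm{Gad}(\sigma)$, an $L_\sigma$-structure ($R$-edges are replaced). The copies of $x_0,\dots,x_\ell$ are the auxiliary vertices; they are exactly the vertices occurring as the last coordinate of an $R_i$-edge for some $i$, and this also describes the auxiliary vertices of an elementary limit of structures $\mathbf A_n^\sigma$. The operation $*_\sigma$. For $\mathbf B=\operatorname{el-lim}\mathbf A_n^\sigma$ and $\mathbf H=\operatorname{el-lim}\mathbf G_n$, the $L$-structure $\mathbf B*_\sigma\mathbf H$ is obtained from $\mathbf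 B$ by replacing, for each $i$, every $R_i$-edge by a new disjoint copy of $\mathbf H_i$, where for $i\ge1$ $\mathbf H_i$ is the connected component of $\mathbf H$ containing the roots $z_j$, $j\in X_i$ (these roots being identified, in increasing order of $j$, with the non-last vertices of the $R_i$-edge), and $\mathbf H_0$ is the (possibly empty) union of the connected components of $\mathbf H$ containing no root; the auxiliary vertices of $\mathbf B$ are removed. -}

module Defs where

open import Data.Nat using (ℕ; zero; suc; _≤_; _<_)
open import Data.Fin using (Fin; zero; suc; _≟_)
open import Data.List using (List; []; length; lookup; filter; allFin)
open import Data.Product using (Σ; ∃; ∃-syntax; _×_; _,_; proj₁; proj₂)
open import Data.Sum using (_⊎_; inj₁; inj₂; [_,_]′)
open import Data.Sum.Properties using (inj₁-injective)
open import Data.Unit using (⊤; tt)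
open import Data.Empty.Polymorphic using (⊥)
open import Data.Vec.Functional using (Vector; init; last) renaming (_∷_ to _∷ᵛ_)
open import Function.Bundles using (_⇔_; _↔_)
open import Function.Definitions using (StrictlySurjective)
open import Level using (Level; _⊔_; 0ℓ) renaming (suc to lsuc)
open import Relation.Binary.Bundles using (Setoid)
open import Relation.Binary.Core using (Rel)
open import Relation.Binary.Construct.Closure.Equivalence using (EqClosure; transitive) renaming (setoid to closureSetoid)
open import Relation.Binary.PropositionalEquality using (_≡_; refl; sym; trans; setoid)
open import Relation.Nullary using (¬_)

private
  variable
    a b s : Level

-- The relation symbols only.  Constants enter as an extra index k of
-- formulas and structures: index 0 is the purely relational case.
record Language : Set₁ where
  field
    Symbol : Set
    arity  : Symbol → ℕ

open Language public

FiniteLanguage : Language → Set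
FiniteLanguage L = ∃[ n ] (Symbol L ↔ Fin n)

PositiveArities : Language → Set
PositiveArities L = ∀ S → 1 ≤ arity L S

infixl 6 _⊕_

_⊕_ : Language → Language → Language
(L ⊕ L′) .Symbol = Symbol L ⊎ Symbol L′
(L ⊕ L′) .arity  = [ arity L , arity L′ ]′

singleSymbol : ℕ → Language
singleSymbol r .Symbol  = ⊤
singleSymbol r .arity _ = r

-- Universes are setoids, so that quotients can be formed; _≈_ is the
-- equality of the universe.  The empty universe is allowed here, and
-- nonemptiness is stated separately where it is not automatic (a gadget has
-- roots, and elementary limits of nonempty structures are nonempty).
record Structure (a : Level) (L : Language) (k : ℕ) : Set (lsuc a) where
  field
    universe : Setoid a a

  open Setoid universe public using (Carrier; _≈_)

  field
    rel      : (S : Symbol L) → Vector Carrier (arity L S) → Set a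
    rel-resp : ∀ S {t u} → (∀ i → t i ≈ u i) → rel S t → rel S u
    const    : Fin k → Carrier

  open Setoid universe public using () renaming (refl to ≈-refl; sym to ≈-sym; trans to ≈-trans)

Nonempty : {L : Language} {k : ℕ} → Structure a L k → Set a
Nonempty M = Structure.Carrier M

data Term (k n : ℕ) : Set where
  var : Fin n → Term k n
  cst : Fin k → Term k n

-- Formulas with n free variables (de Bruijn indices).  The remaining
-- connectives and ∀ are, classically, definable from these.
data Formula (L : Language) (k n : ℕ) : Set where
  _≐_  : Term k n → Term k n → Formula L k n
  atom : (S : Symbol L) → Vector (Term k n) (arity L S) → Formula L k n
  ¬̇_   : Formula L k n → Formula L k n
  _∧̇_  : Formula L k n → Formula L k n → Formula L k n
  ∃̇_   : Formula L k (suc n) → Formula L k n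

Sentence : Language → ℕ → Set
Sentence L k = Formula L k 0

module _ {L : Language} {k : ℕ} (M : Structure a L k) where
  open Structure M

  ⟦_⟧ : {n : ℕ} → Term k n → Vector Carrier n → Carrier
  ⟦ var i ⟧ ρ = ρ i
  ⟦ cst c ⟧ ρ = const c

  Sat : {n : ℕ} → Formula L k n → Vector Carrier n → Set a
  Sat (t ≐ u)    ρ = ⟦ t ⟧ ρ ≈ ⟦ u ⟧ ρ
  Sat (atom S t) ρ = rel S (λ i → ⟦ t i ⟧ ρ)
  Sat (¬̇ φ)      ρ = ¬ Sat φ ρ
  Sat (φ ∧̇ ψ)    ρ = Sat φ ρ × Sat ψ ρ
  Sat (∃̇ φ)      ρ = Σ Carrier λ x → Sat φ (x ∷ᵛ ρ)

infix 4 _⊨_ _≡ᵉ_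

_⊨_ : {L : Language} {k : ℕ} → Structure a L k → Sentence L k → Set a
M ⊨ φ = Sat M φ (λ ())

_≡ᵉ_ : {L : Language} {k : ℕ} → Structure a L k → Structure b L k → Set (a ⊔ b)
M ≡ᵉ N = ∀ φ → M ⊨ φ ⇔ N ⊨ φ

Eventually : (ℕ → Set a) → Set a
Eventually P = ∃[ N ] (∀ n → N ≤ n → P n)

ElementarilyConvergent : {L : Language} {k : ℕ} → (ℕ → Structure a L k) → Set a
ElementarilyConvergent M =
  ∀ φ → Eventually (λ n → M n ⊨ φ) ⊎ Eventually (λ n → M n ⊨ (¬̇ φ))

IsElementaryLimit : {L : Language} {k : ℕ} → Structure b L k → (ℕ → Structure a L k) → Set (a ⊔ b)
IsElementaryLimit M∞ M = ∀ φ → M∞ ⊨ φ ⇔ Eventually (λ n → M n ⊨ φ)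

module _ {L : Language} {k : ℕ} (M : Structure a L k) where
  open Structure M

  GaifmanAdjacent : Rel Carrier a
  GaifmanAdjacent x y =
    ¬ (x ≈ y) × ∃[ S ] ∃[ t ] (rel S t × ∃[ p ] ∃[ q ] (t p ≈ x × t q ≈ y))

  data Walk (x y : Carrier) : ℕ → Set a where
    stop : x ≈ y → Walk x y 0
    step : {z : Carrier} {n : ℕ} → GaifmanAdjacent x z → Walk z y n → Walk x y (suc n)

  Connected : Rel Carrier a
  Connected x y = ∃[ n ] Walk x y n

  HasDistance : Carrier → Carrier → ℕ → Set a
  HasDistance x y d = Walk x y d × (∀ n → n < d → ¬ Walk x y n)

BaseStructure : (a : Level) → Language → ℕ → Set (lsuc a)
BaseStructure a L r = Structure a (L ⊕ singleSymbol r) 0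

record Gadget (a : Level) (L : Language) (r : ℕ) : Set (lsuc a) where
  field
    structure : Structure a L r

  open Structure structure public

  field
    roots-distinct : ∀ i j → const i ≈ const j → i ≡ j

-- A sequence in ℕ ∪ {∞} has a finite limit exactly when it is eventually
-- constant with a finite value.
FiniteLimitDistance : {L : Language} {r : ℕ} → (ℕ → Gadget a L r) → Rel (Fin r) a
FiniteLimitDistance G i j =
  ∃[ d ] Eventually (λ n →
    HasDistance (Gadget.structure (G n)) (Gadget.const (G n) i) (Gadget.const (G n) j) d)

module GadgetConstruction {L : Language} {r : ℕ} (A : BaseStructure a L r) (G : Gadget b L r) where
  private
    module A = Structure A
    module G = Gadget G

  Edge : Set a
  Edge = Σ (Vector A.Carrier r) (A.rel (inj₂ tt))

  Vertex : Set (a ⊔ b)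
  Vertex = A.Carrier ⊎ (Edge × G.Carrier)

  -- Besides the identification of roots, the generators contain the
  -- equalities of the universes of A and G; two edges are the same when
  -- their tuples are, whatever the proof of membership.
  data Glue : Rel Vertex (a ⊔ b) where
    base : ∀ {x y} → x A.≈ y → Glue (inj₁ x) (inj₁ y)
    copy : ∀ {e f v w} → (∀ i → proj₁ e i A.≈ proj₁ f i) → v G.≈ w →
           Glue (inj₂ (e , v)) (inj₂ (f , w))
    root : ∀ e i → Glue (inj₁ (proj₁ e i)) (inj₂ (e , G.const i))

  _∼_ : Rel Vertex (a ⊔ b)
  _∼_ = EqClosure Glue

  data Relation (S : Symbol L) (t : Vector Vertex (arity L S)) : Set (a ⊔ b) where
    fromBase   : ∀ x → A.rel (inj₁ S) x → (∀ i → inj₁ (x i) ∼ t i) → Relation S t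
    fromGadget : ∀ e v → G.rel S v → (∀ i → inj₂ (e , v i) ∼ t i) → Relation S t

  result : Structure (a ⊔ b) L 0
  result .Structure.universe = closureSetoid Glue
  result .Structure.rel      = Relation
  result .Structure.rel-resp S t∼u (fromBase x Sx x∼t) =
    fromBase x Sx (λ i → transitive Glue (x∼t i) (t∼u i))
  result .Structure.rel-resp S t∼u (fromGadget e v Sv v∼t) =
    fromGadget e v Sv (λ i → transitive Glue (v∼t i) (t∼u i))
  result .Structure.const ()

infixl 7 _✶_

_✶_ : {L : Language} {r : ℕ} → BaseStructure a L r → Gadget b L r → Structure (a ⊔ b) L 0
A ✶ G = GadgetConstruction.result A G

-- An enumeration of the classes of σ, without repetition; the existence
-- of one says in particular that σ is an equivalence.
record Classes {r : ℕ} (σ : Rel (Fin r) s) : Set s where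
  field
    count            : ℕ
    class            : Fin r → Fin count
    class-surjective : StrictlySurjective _≡_ class
    class-σ          : ∀ i j → class i ≡ class j ⇔ σ i j

module _ {r : ℕ} {σ : Rel (Fin r) s} (π : Classes σ) where
  open Classes π

  -- X zero is the empty set X₀ and X (suc i) is the class numbered i, both
  -- listed in increasing order.
  X : Fin (suc count) → List (Fin r)
  X zero    = []
  X (suc i) = filter (λ j → class j ≟ i) (allFin r)

  fragmentSymbols : Language
  fragmentSymbols .Symbol  = Fin (suc count)
  fragmentSymbols .arity i = suc (length (X i))

  fragmentLanguage : Language → Language
  fragmentLanguage L = L ⊕ fragmentSymbols

  GadVertex : Set
  GadVertex = Fin r ⊎ Fin (suc count)

  GadRelation : (L : Language) (S : Symbol (fragmentLanguage L)) →
                Vector GadVertex (arity (fragmentLanguage L) S) → Set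
  GadRelation L (inj₁ S) t = ⊥
  GadRelation L (inj₂ i) t = (∀ j → init t j ≡ inj₁ (lookup (X i) j)) × last t ≡ inj₂ i

  Gad : (L : Language) → Gadget 0ℓ (fragmentLanguage L) r
  Gad L .Gadget.structure .Structure.universe = setoid GadVertex
  Gad L .Gadget.structure .Structure.rel      = GadRelation L
  Gad L .Gadget.structure .Structure.rel-resp (inj₁ S) t≡u ()
  Gad L .Gadget.structure .Structure.rel-resp (inj₂ i) t≡u (roots , aux) =
    (λ j → trans (sym (t≡u _)) (roots j)) , trans (sym (t≡u _)) aux
  Gad L .Gadget.structure .Structure.const i = inj₁ i
  Gad L .Gadget.roots-distinct i j = inj₁-injective

  -- A base structure has no edges of the new symbols.
  expand : {L : Language} → BaseStructure a L r → BaseStructure a (fragmentLanguage L) r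
  expand A .Structure.universe = Structure.universe A
  expand A .Structure.rel (inj₁ (inj₁ S)) = Structure.rel A (inj₁ S)
  expand A .Structure.rel (inj₁ (inj₂ i)) = λ _ → ⊥
  expand A .Structure.rel (inj₂ tt)       = Structure.rel A (inj₂ tt)
  expand A .Structure.rel-resp (inj₁ (inj₁ S)) = Structure.rel-resp A (inj₁ S)
  expand A .Structure.rel-resp (inj₁ (inj₂ i)) _ ()
  expand A .Structure.rel-resp (inj₂ tt)       = Structure.rel-resp A (inj₂ tt)
  expand A .Structure.const = Structure.const A

  fragment : {L : Language} → BaseStructure a L r → Structure a (fragmentLanguage L) 0
  fragment {L = L} A = expand A ✶ Gad L

module FragmentReplacement
  {L : Language} {r : ℕ} {σ : Rel (Fin r) s} (π : Classes σ)
  (B : Structure a (fragmentLanguage π L) 0) (H : Structure b L r) where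

  open Classes π
  private
    module B = Structure B
    module H = Structure H

  IsAuxiliary : B.Carrier → Set a
  IsAuxiliary x = ∃[ i ] ∃[ t ] (B.rel (inj₂ i) t × last t B.≈ x)

  -- The vertex set of Hᵢ.  For an elementary limit H, the roots of one class
  -- lie in one component, so the union over j is a single component.
  Part : Fin (suc count) → H.Carrier → Set b
  Part zero    v = ∀ j → ¬ Connected H (H.const j) v
  Part (suc i) v = ∃[ j ] (class j ≡ i × Connected H (H.const j) v)

  Edge : Fin (suc count) → Set a
  Edge i = Σ (Vector B.Carrier (suc (length (X π i)))) (B.rel (inj₂ i))

  PartVertex : Fin (suc count) → Set b
  PartVertex i = Σ H.Carrier (Part i)

  Vertex : Set (a ⊔ b)
  Vertex = Σ B.Carrier (λ x → ¬ IsAuxiliary x) ⊎ (∃[ i ] (Edge i × PartVertex i))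

  -- Proofs of membership are irrelevant to the identity of a vertex, hence
  -- the root identification is stated up to the equalities of B and H.
  data Glue : Rel Vertex (a ⊔ b) where
    base : ∀ {x y} → proj₁ x B.≈ proj₁ y → Glue (inj₁ x) (inj₁ y)
    copy : ∀ {i} {e f : Edge i} {v w : PartVertex i} →
           (∀ j → proj₁ e j B.≈ proj₁ f j) → proj₁ v H.≈ proj₁ w →
           Glue (inj₂ (i , e , v)) (inj₂ (i , f , w))
    root : ∀ {x i} {e : Edge i} {v : PartVertex i} (j : Fin (length (X π i))) →
           proj₁ x B.≈ init (proj₁ e) j → proj₁ v H.≈ H.const (lookup (X π i) j) →
           Glue (inj₁ x) (inj₂ (i , e , v))

  _∼_ : Rel Vertex (a ⊔ b)
  _∼_ = EqClosure Glue

  data Relation (S : Symbol L) (t : Vector Vertex (arity L S)) : Set (a ⊔ b) where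
    fromBase : (x : Vector (Σ B.Carrier (λ x → ¬ IsAuxiliary x)) (arity L S)) →
               B.rel (inj₁ S) (λ p → proj₁ (x p)) → (∀ p → inj₁ (x p) ∼ t p) → Relation S t
    fromPart : ∀ i (e : Edge i) (v : Vector (PartVertex i) (arity L S)) →
               H.rel S (λ p → proj₁ (v p)) → (∀ p → inj₂ (i , e , v p) ∼ t p) → Relation S t

  result : Structure (a ⊔ b) L 0
  result .Structure.universe = closureSetoid Glue
  result .Structure.rel      = Relation
  result .Structure.rel-resp S t∼u (fromBase x Sx x∼t) =
    fromBase x Sx (λ p → transitive Glue (x∼t p) (t∼u p))
  result .Structure.rel-resp S t∼u (fromPart i e v Sv v∼t) =
    fromPart i e v Sv (λ p → transitive Glue (v∼t p) (t∼u p))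
  result .Structure.const ()

replaceFragments : {L : Language} {r : ℕ} {σ : Rel (Fin r) s} (π : Classes σ) →
                   Structure a (fragmentLanguage π L) 0 → Structure b L r → Structure (a ⊔ b) L 0
replaceFragments π B H = FragmentReplacement.result π B H

syntax replaceFragments π B H = B ✶[ π ] H

{-# OPTIONS --safe #-}

-- B ✶[ π ] H is an elementary limit of the structures A n ✶ G n because
-- winning strategies for back-and-forth games can be composed.  The Duplicator
-- keeps one game between fragment π (A n) and B and, for every edge e of A n
-- touched so far, one game between G n and H.  An edge e is answered by
-- playing all its vertices and all its auxiliary vertices in the first game;
-- the reply is one Rᵢ-edge of B for each i, and these Rᵢ-edges need not be
-- related in any other way.  Since roots of different classes lie in different
-- components of H, the components glued to these Rᵢ-edges together behave like
-- a single copy of H.  Convergence follows once limits B and H are known to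
-- exist, and these are obtained by a Henkin construction.

module Submission where

open import Defs
open import Axiom.ExcludedMiddle using (ExcludedMiddle)
open import Data.Empty.Polymorphic using (⊥)
open import Data.Fin using (Fin; zero; suc; inject₁; fromℕ; _≟_)
open import Data.Fin.Properties using (+↔⊎)
open import Data.Fin.Relation.Unary.Top using (view; view-fromℕ; view-inject₁; ‵fromℕ; ‵inject₁)
open import Data.List using (List; []; _∷_; _++_; map; concatMap; cartesianProductWith; foldl; lookup; length; allFin; upTo)
open import Data.List.Membership.Propositional using (_∈_; lose)
open import Data.List.Membership.Propositional.Properties
  using (∈-map⁺; ∈-++⁺ˡ; ∈-++⁺ʳ; ∈-concatMap⁺; ∈-cartesianProductWith⁺; ∈-filter⁺; ∈-filter⁻; ∈-allFin; ∈-upTo⁺; ∈-lookup)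
open import Data.List.Properties using (length-filter; length-tabulate)
import Data.List.Relation.Unary.All as All
import Data.List.Relation.Unary.AllPairs as AllPairs
open import Data.List.Relation.Unary.Any using (here; there; index)
open import Data.List.Relation.Unary.Any.Properties using (lookup-index)
open import Data.List.Relation.Unary.Unique.Propositional using (Unique)
open import Data.List.Relation.Unary.Unique.Propositional.Properties using (allFin⁺; filter⁺)
open import Data.Maybe using (Maybe; just; nothing)
open import Data.Nat using (ℕ; zero; suc; _≤_; _<_; _+_; _*_; _⊔_; z≤n; s≤s)
import Data.Nat.Properties as ℕ
open import Data.Product using (∃; ∃-syntax; _×_; _,_; proj₁; proj₂)
open import Data.Product.Relation.Binary.Pointwise.NonDependent using (×-setoid)
open import Data.Sum using (_⊎_; inj₁; inj₂; [_,_]′)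
open import Data.Sum.Function.Propositional using (_⊎-↔_)
import Data.Sum.Relation.Binary.Pointwise as Pointwise
open Pointwise using (drop-inj₁; ⊎-setoid)
open import Data.Unit using (tt)
open import Data.Unit.Polymorphic using (⊤)
open import Data.Vec.Functional using (Vector; init; last) renaming (_∷_ to _∷ᵛ_)
import Data.Vec.Functional.Relation.Binary.Equality.Setoid as VecEq
open import Function using (_∘_; flip; id; _⇔_; mk⇔; Inverse; Equivalence)
open import Function.Construct.Composition using (_⇔-∘_; _↔-∘_)
open import Function.Construct.Identity using (↔-id)
open import Function.Construct.Symmetry using (⇔-sym; ↔-sym)
open import Level using (Level; Lift; lift) renaming (_⊔_ to _⊔ˡ_; suc to lsuc)
open import Relation.Binary.Bundles using (Setoid)
open import Relation.Binary.Construct.Closure.Equivalence using (gfold; return; symmetric; transitive; reflexive)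
import Relation.Binary.Construct.On as On
open import Relation.Binary.Core using (Rel; REL)
open import Relation.Binary.PropositionalEquality using (_≡_; refl; sym; trans; cong; subst; _≗_)
open import Relation.Nullary using (¬_; Dec; yes; no; contradiction)

open Equivalence using (to; from)

-- The delicate moves are those made in B: an Rᵢ-edge picked there shows the roots of one class
-- only, while its counterpart must be a whole edge of A. The auxiliary vertices close this gap.
-- Each of them lies in just one copy of `Gad`, so the last coordinate of an Rᵢ-edge determines the
-- edge of A behind it, even if several edges of A share vertices, and also for i = 0, where there
-- is no other coordinate. Hence the Duplicator first plays the Rᵢ-edge back, in at most r + 1
-- rounds, and then completes the edge found there by answering all vertices of its copy of `Gad`.
-- This explains `cost`. A relation can also come from an edge not touched so far, since its tuple
-- may consist of roots; the same amount is therefore held in reserve, and q rounds of the composed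
-- game take (q + 1) * `cost` rounds of the first one. Equality in a glued structure is generated by
-- chains of identifications. A normal form for vertices reduces it to equality in the structures
-- that were glued.

private
  variable
    a b s ℓ : Level

-- Finite enumerations

vectors : {A : Set a} → List A → (n : ℕ) → List (Vector A n)
vectors xs zero    = (λ ()) ∷ []
vectors xs (suc n) = cartesianProductWith _∷ᵛ_ xs (vectors xs n)

-- Vectors are functions; without function extensionality only a pointwise equal copy of f can be
-- found in the list.
vectors-complete : {A : Set a} {xs : List A} {n : ℕ} (f : Vector A n) →
                   (∀ i → f i ∈ xs) → ∃[ g ] (g ∈ vectors xs n × f ≗ g)
vectors-complete {n = zero}  f f∈ = _ , here refl , λ ()
vectors-complete {n = suc n} f f∈ with vectors-complete (f ∘ suc) (f∈ ∘ suc)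
... | g , g∈ , f≗g = f zero ∷ᵛ g , ∈-cartesianProductWith⁺ _∷ᵛ_ (f∈ zero) g∈ , eq
  where
  eq : f ≗ f zero ∷ᵛ g
  eq zero    = refl
  eq (suc i) = f≗g i

terms : (k n : ℕ) → List (Term k n)
terms k n = map var (allFin n) ++ map cst (allFin k)

∈-terms : {k n : ℕ} (t : Term k n) → t ∈ terms k n
∈-terms (var i) = ∈-++⁺ˡ (∈-map⁺ var (∈-allFin i))
∈-terms (cst c) = ∈-++⁺ʳ _ (∈-map⁺ cst (∈-allFin c))

symbols : {L : Language} → FiniteLanguage L → List (Symbol L)
symbols (n , e) = map (Inverse.from e) (allFin n)

∈-symbols : {L : Language} (fin : FiniteLanguage L) (S : Symbol L) → S ∈ symbols {L} fin
∈-symbols (n , e) S =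
  subst (_∈ _) (Inverse.strictlyInverseʳ e S) (∈-map⁺ (Inverse.from e) (∈-allFin (Inverse.to e S)))

module _ {L : Language} (fin : FiniteLanguage L) {k : ℕ} where

  equations : (n : ℕ) → List (Formula L k n)
  equations n = cartesianProductWith _≐_ (terms k n) (terms k n)

  atomsOf : (n : ℕ) → Symbol L → List (Formula L k n)
  atomsOf n S = map (atom S) (vectors (terms k n) (arity L S))

  atomics : (n : ℕ) → List (Formula L k n)
  atomics n = equations n ++ concatMap (atomsOf n) (symbols {L} fin)

  ∈-atomics-≐ : {n : ℕ} (t u : Term k n) → (t ≐ u) ∈ atomics n
  ∈-atomics-≐ t u = ∈-++⁺ˡ (∈-cartesianProductWith⁺ _≐_ (∈-terms t) (∈-terms u))

  ∈-atomics-atom : {n : ℕ} (S : Symbol L) (t : Vector (Term k n) (arity L S)) →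
                   ∃[ u ] (t ≗ u × atom S u ∈ atomics n)
  ∈-atomics-atom {n} S t with vectors-complete t (∈-terms ∘ t)
  ... | u , u∈ , t≗u = u , t≗u ,
    ∈-++⁺ʳ (equations n) (∈-concatMap⁺ (atomsOf n) (lose (∈-symbols {L} fin S) (∈-map⁺ (atom S) u∈)))

  -- One formula for each choice of truth values on the list. The trivial equation ends the
  -- conjunction, as the syntax has no constant for truth.
  descriptions : {n : ℕ} → List (Formula L k (suc n)) → List (Formula L k (suc n))
  descriptions []       = (var zero ≐ var zero) ∷ []
  descriptions (φ ∷ φs) = map (φ ∧̇_) (descriptions φs) ++ map ((¬̇ φ) ∧̇_) (descriptions φs)

  -- Agreement on the list of rank q forces the Duplicator to win q rounds.
  rankFormulas : (q n : ℕ) → List (Formula L k n)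
  rankFormulas zero    n = atomics n
  rankFormulas (suc q) n = atomics n ++ map ∃̇_ (descriptions (rankFormulas q (suc n)))

-- Quantifier rank, and invariance of satisfaction under equality of the universe

quantifierRank : {L : Language} {k n : ℕ} → Formula L k n → ℕ
quantifierRank (t ≐ u)    = 0
quantifierRank (atom S t) = 0
quantifierRank (¬̇ φ)      = quantifierRank φ
quantifierRank (φ ∧̇ ψ)    = quantifierRank φ ⊔ quantifierRank ψ
quantifierRank (∃̇ φ)      = suc (quantifierRank φ)

module _ {L : Language} {k : ℕ} (M : Structure ℓ L k) where
  open Structure M

  ⟦⟧-resp : {n : ℕ} (t : Term k n) {ρ τ : Vector Carrier n} → (∀ i → ρ i ≈ τ i) → ⟦_⟧ M t ρ ≈ ⟦_⟧ M t τ
  ⟦⟧-resp (var i) e = e i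
  ⟦⟧-resp (cst c) e = ≈-refl

  ∷-resp : {n : ℕ} {ρ τ : Vector Carrier n} (x : Carrier) → (∀ i → ρ i ≈ τ i) → ∀ i → (x ∷ᵛ ρ) i ≈ (x ∷ᵛ τ) i
  ∷-resp x e zero    = ≈-refl
  ∷-resp x e (suc i) = e i

  Sat-resp : {n : ℕ} (φ : Formula L k n) {ρ τ : Vector Carrier n} → (∀ i → ρ i ≈ τ i) → Sat M φ ρ → Sat M φ τ
  Sat-resp (t ≐ u)    e s       = ≈-trans (≈-sym (⟦⟧-resp t e)) (≈-trans s (⟦⟧-resp u e))
  Sat-resp (atom S t) e s       = rel-resp S (λ i → ⟦⟧-resp (t i) e) s
  Sat-resp (¬̇ φ)      e s s′    = s (Sat-resp φ (≈-sym ∘ e) s′)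
  Sat-resp (φ ∧̇ ψ)    e (s , u) = Sat-resp φ e s , Sat-resp ψ e u
  Sat-resp (∃̇ φ)      e (x , s) = x , Sat-resp φ (∷-resp x e) s

-- Two functions out of Fin 0 need not be definitionally equal.
closed-⇔ : {L : Language} {k : ℕ} (M N : Structure ℓ L k) (φ : Sentence L k) {ρ : Vector _ 0} {τ : Vector _ 0} →
           M ⊨ φ ⇔ N ⊨ φ → Sat M φ ρ ⇔ Sat N φ τ
closed-⇔ M N φ e = mk⇔ (Sat-resp N φ (λ ()) ∘ to e ∘ Sat-resp M φ (λ ()))
                       (Sat-resp M φ (λ ()) ∘ from e ∘ Sat-resp N φ (λ ()))

-- Back-and-forth games.  A position is the relation consisting of the pairs
-- of elements chosen so far.

module Game {L : Language} {k : ℕ} (M : Structure ℓ L k) (N : Structure ℓ L k) where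
  private
    module M = Structure M
    module N = Structure N

  Position : Set _
  Position = REL M.Carrier N.Carrier ℓ

  infixl 5 _▷_

  _▷_ : Position → M.Carrier × N.Carrier → Position
  (P ▷ (x , y)) u v = P u v ⊎ (u M.≈ x × v N.≈ y)

  _▷▷_ : {n : ℕ} → Position → Vector M.Carrier n × Vector N.Carrier n → Position
  (P ▷▷ (x , y)) u v = P u v ⊎ ∃[ i ] (u M.≈ x i × v N.≈ y i)

  record Atomic (P : Position) : Set ℓ where
    field
      eq-iff  : ∀ {x x′ y y′} → P x y → P x′ y′ → (x M.≈ x′) ⇔ (y N.≈ y′)
      rel-iff : ∀ S {t u} → (∀ i → P (t i) (u i)) → M.rel S t ⇔ N.rel S u

  data Wins (P : Position) : ℕ → Set ℓ where
    done : Atomic P → Wins P 0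
    move : ∀ {q} → Atomic P → (∀ x → ∃[ y ] Wins (P ▷ (x , y)) q) → (∀ y → ∃[ x ] Wins (P ▷ (x , y)) q) →
           Wins P (suc q)

  atomic : ∀ {P q} → Wins P q → Atomic P
  atomic (done at)     = at
  atomic (move at _ _) = at

  constants : Position
  constants x y = ∃[ c ] (x M.≈ M.const c × y N.≈ N.const c)

open Game using (Wins; done; move; Atomic; atomic; constants)
open Atomic

module _ {L : Language} {k : ℕ} {M : Structure ℓ L k} {N : Structure ℓ L k} where
  private
    module M = Structure M
    module N = Structure N
  open Game M N using (Position; _▷_; _▷▷_)

  infix 4 _⊆_

  _⊆_ : Position → Position → Set ℓ
  Q ⊆ P = ∀ {x y} → Q x y → P x y

  ▷-mono : ∀ {P Q x y} → Q ⊆ P → Q ▷ (x , y) ⊆ P ▷ (x , y)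
  ▷-mono Q⊆P (inj₁ p) = inj₁ (Q⊆P p)
  ▷-mono Q⊆P (inj₂ e) = inj₂ e

  Atomic-⊆ : ∀ {P Q} → Q ⊆ P → Atomic M N P → Atomic M N Q
  Atomic-⊆ Q⊆P at .eq-iff  p p′ = eq-iff at (Q⊆P p) (Q⊆P p′)
  Atomic-⊆ Q⊆P at .rel-iff S p  = rel-iff at S (Q⊆P ∘ p)

  -- Forgetting pairs never hurts the Duplicator, so positions have to be controlled only up to
  -- inclusion.
  Wins-⊆ : ∀ {P Q q} → Q ⊆ P → Wins M N P q → Wins M N Q q
  Wins-⊆ Q⊆P (done at) = done (Atomic-⊆ Q⊆P at)
  Wins-⊆ {P} {Q} Q⊆P (move at f g) = move (Atomic-⊆ Q⊆P at)
    (λ x → let y , w = f x in y , Wins-⊆ (▷-mono {P} {Q} Q⊆P) w)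
    (λ y → let x , w = g y in x , Wins-⊆ (▷-mono {P} {Q} Q⊆P) w)

  lower : ∀ {P p q} → p ≤ q → Wins M N P q → Wins M N P p
  lower z≤n       w             = done (atomic M N w)
  lower (s≤s p≤q) (move at f g) = move at
    (λ x → let y , w = f x in y , lower p≤q w)
    (λ y → let x , w = g y in x , lower p≤q w)

  forth : ∀ {P q} → Wins M N P (suc q) → ∀ x → ∃[ y ] Wins M N (P ▷ (x , y)) q
  forth (move _ f _) = f

  back : ∀ {P q} → Wins M N P (suc q) → ∀ y → ∃[ x ] Wins M N (P ▷ (x , y)) q
  back (move _ _ g) = g

  forths : ∀ {P q} (n : ℕ) → Wins M N P (n + q) → (x : Vector M.Carrier n) → ∃[ y ] Wins M N (P ▷▷ (x , y)) q
  forths zero w x = (λ ()) , Wins-⊆ (λ { (inj₁ p) → p ; (inj₂ (() , _)) }) w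
  forths {P} (suc n) w x =
    let y₀ , w₀ = forth w (x zero)
        y , w′  = forths n w₀ (x ∘ suc)
    in y₀ ∷ᵛ y , Wins-⊆ (λ { (inj₁ p)              → inj₁ (inj₁ p)
                           ; (inj₂ (zero , e))     → inj₁ (inj₂ e)
                           ; (inj₂ (suc i , e))    → inj₂ (i , e) }) w′

  backs : ∀ {P q} (n : ℕ) → Wins M N P (n + q) → (y : Vector N.Carrier n) → ∃[ x ] Wins M N (P ▷▷ (x , y)) q
  backs zero w x = (λ ()) , Wins-⊆ (λ { (inj₁ p) → p ; (inj₂ (() , _)) }) w
  backs {P} (suc n) w y =
    let x₀ , w₀ = back w (y zero)
        x , w′  = backs n w₀ (y ∘ suc)
    in x₀ ∷ᵛ x , Wins-⊆ (λ { (inj₁ p)              → inj₁ (inj₁ p)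
                           ; (inj₂ (zero , e))     → inj₁ (inj₂ e)
                           ; (inj₂ (suc i , e))    → inj₂ (i , e) }) w′

  ∷-related : ∀ {n P x y} {ρ : Vector M.Carrier n} {τ : Vector N.Carrier n} →
              (∀ i → P (ρ i) (τ i)) → ∀ i → (P ▷ (x , y)) ((x ∷ᵛ ρ) i) ((y ∷ᵛ τ) i)
  ∷-related p zero    = inj₂ (M.≈-refl , N.≈-refl)
  ∷-related p (suc i) = inj₁ (p i)

  wins⇒Sat : ∀ {n P q} (φ : Formula L k n) → quantifierRank φ ≤ q → Wins M N P q →
             (∀ c → P (M.const c) (N.const c)) →
             ∀ {ρ τ} → (∀ i → P (ρ i) (τ i)) → Sat M φ ρ ⇔ Sat N φ τ
  wins⇒Sat {P = P} (t ≐ u) _ w con p = eq-iff (atomic M N w) (term t) (term u)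
    where
    term : ∀ t → P (⟦_⟧ M t _) (⟦_⟧ N t _)
    term (var i) = p i
    term (cst c) = con c
  wins⇒Sat {P = P} (atom S t) _ w con p = rel-iff (atomic M N w) S (term ∘ t)
    where
    term : ∀ t → P (⟦_⟧ M t _) (⟦_⟧ N t _)
    term (var i) = p i
    term (cst c) = con c
  wins⇒Sat (¬̇ φ) r w con p =
    let e = wins⇒Sat φ r w con p in mk⇔ (_∘ from e) (_∘ to e)
  wins⇒Sat (φ ∧̇ ψ) r w con p =
    let e = wins⇒Sat φ (ℕ.m⊔n≤o⇒m≤o _ _ r) w con p
        f = wins⇒Sat ψ (ℕ.m⊔n≤o⇒n≤o (quantifierRank φ) _ r) w con p
    in mk⇔ (λ (s , u) → to e s , to f u) (λ (s , u) → from e s , from f u)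
  wins⇒Sat {P = P} (∃̇ φ) (s≤s r) (move _ f g) con p = mk⇔
    (λ (x , s) → let y , w = f x in
      y , to (wins⇒Sat φ r w (inj₁ ∘ con) (∷-related {P = P} p)) s)
    (λ (y , s) → let x , w = g y in
      x , from (wins⇒Sat φ r w (inj₁ ∘ con) (∷-related {P = P} p)) s)

module _ {L : Language} {k : ℕ} {M : Structure ℓ L k} {N : Structure ℓ L k} where

  flip-atomic : ∀ {P} → Atomic M N P → Atomic N M (flip P)
  flip-atomic at .eq-iff  p p′ = ⇔-sym (eq-iff at p p′)
  flip-atomic at .rel-iff S p  = ⇔-sym (rel-iff at S p)

  flip-wins : ∀ {P q} → Wins M N P q → Wins N M (flip P) q
  flip-wins (done at)     = done (flip-atomic at)
  flip-wins (move at f g) = move (flip-atomic at)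
    (λ y → let x , w = g y in x , Wins-⊆ (λ { (inj₁ p) → inj₁ p ; (inj₂ (e , e′)) → inj₂ (e′ , e) }) (flip-wins w))
    (λ x → let y , w = f x in y , Wins-⊆ (λ { (inj₁ p) → inj₁ p ; (inj₂ (e , e′)) → inj₂ (e′ , e) }) (flip-wins w))

-- From agreement on finitely many sentences to winning strategies

eventually-map : {P Q : ℕ → Set ℓ} → (∀ n → P n → Q n) → Eventually P → Eventually Q
eventually-map f (N , h) = N , λ n N≤n → f n (h n N≤n)

eventually-× : {P Q : ℕ → Set ℓ} → Eventually P → Eventually Q → Eventually (λ n → P n × Q n)
eventually-× (N , h) (N′ , h′) = N ⊔ N′ , λ n m →
  h n (ℕ.m⊔n≤o⇒m≤o N N′ m) , h′ n (ℕ.m⊔n≤o⇒n≤o N N′ m)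

module _ (em : ExcludedMiddle ℓ) {L : Language} (fin : FiniteLanguage L) {k : ℕ} where

  Agree : (M N : Structure ℓ L k) {n : ℕ} → List (Formula L k n) →
          Vector (Structure.Carrier M) n → Vector (Structure.Carrier N) n → Set ℓ
  Agree M N φs ρ τ = ∀ {φ} → φ ∈ φs → Sat M φ ρ ⇔ Sat N φ τ

  description : (M : Structure ℓ L k) {n : ℕ} (φs : List (Formula L k (suc n))) (ρ : Vector _ (suc n)) →
    ∃[ χ ] (χ ∈ descriptions fin φs × Sat M χ ρ × (∀ (N : Structure ℓ L k) τ → Sat N χ τ → Agree M N φs ρ τ))
  description M []       ρ = (var zero ≐ var zero) , here refl , Structure.≈-refl M {ρ zero} , λ _ _ _ ()
  description M (φ ∷ φs) ρ with description M φs ρ | em {Sat M φ ρ}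
  ... | χ , χ∈ , s , agree | yes p = φ ∧̇ χ , ∈-++⁺ˡ (∈-map⁺ _ χ∈) , (p , s) , λ N τ (p′ , s′) →
    λ { (here refl) → mk⇔ (λ _ → p′) (λ _ → p) ; (there m) → agree N τ s′ m }
  ... | χ , χ∈ , s , agree | no ¬p = (¬̇ φ) ∧̇ χ , ∈-++⁺ʳ _ (∈-map⁺ _ χ∈) , (¬p , s) , λ N τ (¬p′ , s′) →
    λ { (here refl) → mk⇔ (λ p → contradiction p ¬p) (λ p′ → contradiction p′ ¬p′) ; (there m) → agree N τ s′ m }

  module _ {M N : Structure ℓ L k} where
    private
      module M = Structure M
      module N = Structure N
    open Game M N using (Position; _▷_)

    -- All terms are included, so the constants belong to the position before the first round.
    named : {n : ℕ} → Vector M.Carrier n → Vector N.Carrier n → Position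
    named ρ τ x y = ∃[ t ] (x M.≈ ⟦_⟧ M t ρ × y N.≈ ⟦_⟧ N t τ)

    named-▷ : ∀ {n x y u v} {ρ : Vector M.Carrier n} {τ : Vector N.Carrier n} →
              (named ρ τ ▷ (x , y)) u v → named (x ∷ᵛ ρ) (y ∷ᵛ τ) u v
    named-▷ (inj₁ (var i , e)) = var (suc i) , e
    named-▷ (inj₁ (cst c , e)) = cst c , e
    named-▷ (inj₂ e)           = var zero , e

    agree⇒atomic : ∀ {n} {ρ : Vector M.Carrier n} {τ : Vector N.Carrier n} →
                   Agree M N (atomics fin n) ρ τ → Atomic M N (named ρ τ)
    agree⇒atomic ag .eq-iff (t , e , f) (u , e′ , f′) =
      let i = ag (∈-atomics-≐ fin t u)
      in mk⇔ (λ x≈ → N.≈-trans f (N.≈-trans (to i (M.≈-trans (M.≈-sym e) (M.≈-trans x≈ e′))) (N.≈-sym f′)))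
             (λ y≈ → M.≈-trans e (M.≈-trans (from i (N.≈-trans (N.≈-sym f) (N.≈-trans y≈ f′))) (M.≈-sym e′)))
    agree⇒atomic {ρ = ρ} {τ} ag .rel-iff S p =
      let u , t≗u , u∈ = ∈-atomics-atom fin S (proj₁ ∘ p)
          i   = ag u∈
          eM j = M.≈-trans (proj₁ (proj₂ (p j))) (subst (λ t → ⟦_⟧ M (proj₁ (p j)) ρ M.≈ ⟦_⟧ M t ρ) (t≗u j) M.≈-refl)
          eN j = N.≈-trans (proj₂ (proj₂ (p j))) (subst (λ t → ⟦_⟧ N (proj₁ (p j)) τ N.≈ ⟦_⟧ N t τ) (t≗u j) N.≈-refl)
      in mk⇔ (λ s → N.rel-resp S (N.≈-sym ∘ eN) (to i (M.rel-resp S eM s)))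
             (λ s → M.rel-resp S (M.≈-sym ∘ eM) (from i (N.rel-resp S eN s)))

  -- The Spoiler's element satisfies a description χ of the next lower rank. As `∃̇ χ` is on the
  -- list, the other structure has an element satisfying χ, and that element agrees with the chosen
  -- one on the lower list.
  agree⇒wins : ∀ (M N : Structure ℓ L k) q {n} {ρ : Vector _ n} {τ : Vector _ n} →
               Agree M N (rankFormulas fin q n) ρ τ → Wins M N (named {M} {N} ρ τ) q
  agree⇒wins M N zero    ag = done (agree⇒atomic ag)
  agree⇒wins M N (suc q) {n} {ρ} {τ} ag = move (agree⇒atomic (ag ∘ ∈-++⁺ˡ)) forth′ back′
    where
    ∈-∃ : ∀ {χ} → χ ∈ descriptions fin (rankFormulas fin q (suc n)) → (∃̇ χ) ∈ rankFormulas fin (suc q) n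
    ∈-∃ χ∈ = ∈-++⁺ʳ (atomics fin n) (∈-map⁺ ∃̇_ χ∈)

    forth′ : ∀ x → _
    forth′ x = let χ , χ∈ , s , agree = description M (rankFormulas fin q (suc n)) (x ∷ᵛ ρ)
                   y , s′ = to (ag (∈-∃ χ∈)) (x , s)
               in y , Wins-⊆ (named-▷ {M} {N}) (agree⇒wins M N q (agree N _ s′))

    back′ : ∀ y → _
    back′ y = let χ , χ∈ , s , agree = description N (rankFormulas fin q (suc n)) (y ∷ᵛ τ)
                  x , s′ = from (ag (∈-∃ χ∈)) (y , s)
              in x , Wins-⊆ (named-▷ {M} {N}) (agree⇒wins M N q (λ m → ⇔-sym (agree M _ s′ m)))

  module _ {M : ℕ → Structure ℓ L k} {M∞ : Structure ℓ L k} (lim : IsElementaryLimit M∞ M) where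

    eventually-⇔ : ∀ φ → Eventually (λ n → M n ⊨ φ ⇔ M∞ ⊨ φ)
    eventually-⇔ φ with em {M∞ ⊨ φ}
    ... | yes p = eventually-map (λ _ s → mk⇔ (λ _ → p) (λ _ → s)) (to (lim φ) p)
    ... | no ¬p = eventually-map (λ _ ¬s → mk⇔ (λ s → contradiction s ¬s) (λ p → contradiction p ¬p)) (to (lim (¬̇ φ)) ¬p)

    eventually-agree : (φs : List (Sentence L k)) →
                       Eventually (λ n → ∀ {φ} → φ ∈ φs → M n ⊨ φ ⇔ M∞ ⊨ φ)
    eventually-agree []       = 0 , λ _ _ ()
    eventually-agree (φ ∷ φs) =
      eventually-map (λ { _ (e , es) (here refl) → e ; _ (e , es) (there m) → es m })
        (eventually-× (eventually-⇔ φ) (eventually-agree φs))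

    -- Finiteness of the language matters here: `rankFormulas` is a finite list, so one threshold
    -- serves all its sentences.
    eventually-wins : ∀ q → Eventually (λ n → Wins (M n) M∞ (constants (M n) M∞) q)
    eventually-wins q = eventually-map
      (λ n ag → Wins-⊆ {P = named {M n} {M∞} (λ ()) (λ ())} (λ (c , e) → cst c , e)
        (agree⇒wins (M n) M∞ q {ρ = λ ()} {τ = λ ()} (λ {φ} m → closed-⇔ (M n) M∞ φ (ag m))))
      (eventually-agree (rankFormulas fin q 0))

-- Gaifman distances and elementary limits

boundedArity : {L : Language} → FiniteLanguage L → ∃[ m ] (∀ S → arity L S ≤ m)
boundedArity {L} fin = let m , h = bound (symbols {L} fin) in m , λ S → h (∈-symbols {L} fin S)
  where
  bound : (Ss : List (Symbol L)) → ∃[ m ] (∀ {S} → S ∈ Ss → arity L S ≤ m)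
  bound []       = 0 , λ ()
  bound (S ∷ Ss) with bound Ss
  ... | m , h = arity L S ⊔ m , λ
    { (here refl) → ℕ.m≤m⊔n _ _ ; (there S∈) → ℕ.≤-trans (h S∈) (ℕ.m≤n⊔m (arity L S) m) }

-- An adjacency is witnessed by a tuple of at most m elements. Playing the whole tuple carries over
-- the relation together with the next vertex of the walk, hence m rounds per step.
walk-transfer : {L : Language} {k : ℕ} {M N : Structure ℓ L k} {m : ℕ} → (∀ S → arity L S ≤ m) →
  ∀ {P x x′ y y′} d → Wins M N P (d * m) → P x x′ → P y y′ → Walk M x y d → Walk N x′ y′ d
walk-transfer {M = M} {N} ar zero w px py (stop e) = stop (to (eq-iff (atomic M N w) px py) e)
walk-transfer {M = M} {N} {m} ar (suc d) w px py (step (x≉z , S , t , St , p , q , tp≈x , tq≈z) walk) =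
  let t′ , w′ = forths _ (lower (ℕ.+-monoˡ-≤ (d * m) (ar S)) w) t
      at      = atomic M N w′
      pz      = inj₂ (q , M.≈-sym tq≈z , N.≈-refl)
      pt i    = inj₂ (i , M.≈-refl , N.≈-refl)
  in step ( x≉z ∘ from (eq-iff at (inj₁ px) pz) , S , t′ , to (rel-iff at S pt) St
          , p , q , to (eq-iff at (pt p) (inj₁ px)) tp≈x , N.≈-refl)
          (walk-transfer ar d w′ pz (inj₁ py) walk)
  where
  module M = Structure M
  module N = Structure N

module _ (em : ExcludedMiddle ℓ) where

  least : (P : ℕ → Set ℓ) → ∀ {d} → P d → ∃[ m ] (P m × (∀ n → n < m → ¬ P n))
  least P {zero}  p = 0 , p , λ _ ()
  least P {suc d} p with em {P 0}
  ... | yes p₀ = 0 , p₀ , λ _ ()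
  ... | no ¬p₀ = let m , pm , h = least (P ∘ suc) {d} p in
    suc m , pm , λ { zero _ → ¬p₀ ; (suc n) (s≤s n<m) → h n n<m }

  -- A shortest walk in H is carried to `G n`, and a shorter walk in `G n` would be carried back.
  -- The distance in `G n` is thus eventually that in H.
  connected⇒finiteDistance : {L : Language} → FiniteLanguage L → {r : ℕ} (G : ℕ → Gadget ℓ L r) (H : Structure ℓ L r) →
    IsElementaryLimit H (Gadget.structure ∘ G) → ∀ i j →
    Connected H (Structure.const H i) (Structure.const H j) → FiniteLimitDistance G i j
  connected⇒finiteDistance {L} fin G H lim i j (_ , walk) with boundedArity {L} fin | least (Walk H _ _) walk
  ... | m , ar | d , walk-d , minimal = d , eventually-map
    (λ n w → walk-transfer ar d (flip-wins w) (con i) (con j) walk-d ,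
             λ d′ d′<d → minimal d′ d′<d ∘
               walk-transfer ar d′ (lower (ℕ.*-monoˡ-≤ m (ℕ.<⇒≤ d′<d)) w) (con′ n i) (con′ n j))
    (eventually-wins em fin lim (d * m))
    where
    con : ∀ {n} c → flip (constants (Gadget.structure (G n)) H) (Structure.const H c) (Gadget.const (G n) c)
    con {n} c = c , Gadget.≈-refl (G n) , Structure.≈-refl H
    con′ : ∀ n c → constants (Gadget.structure (G n)) H (Gadget.const (G n) c) (Structure.const H c)
    con′ n c = con {n} c

-- Normal forms in the glued structures

-- Every vertex of A ✶ G is a vertex of A or a non-root vertex of one copy of
-- G, and normalForm chooses this representative.
module Charts {L : Language} {r : ℕ} (A : BaseStructure a L r) (G : Gadget b L r)
  (root? : ∀ v → Dec (∃[ i ] (Structure._≈_ (Gadget.structure G) v (Gadget.const G i)))) where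

  private
    module A = Structure A
    module G = Gadget G
  open GadgetConstruction A G

  Root : G.Carrier → Set b
  Root v = ∃[ i ] (v G.≈ G.const i)

  edgeSetoid : Setoid a a
  edgeSetoid = On.setoid (VecEq.≋-setoid A.universe r) (proj₁ {B = A.rel (inj₂ tt)})

  normalSetoid : Setoid (a ⊔ˡ b) (a ⊔ˡ b)
  normalSetoid = ⊎-setoid A.universe (×-setoid edgeSetoid G.universe)

  private
    module N = Setoid normalSetoid

  normalForm : Vertex → N.Carrier
  normalForm (inj₁ x) = inj₁ x
  normalForm (inj₂ (e , v)) with root? v
  ... | yes (i , _) = inj₁ (proj₁ e i)
  ... | no  _       = inj₂ (e , v)

  normalForm-glue : ∀ {x y} → Glue x y → normalForm x N.≈ normalForm y
  normalForm-glue (base p) = Pointwise.inj₁ p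
  normalForm-glue (copy {e} {f} {v} {w} e≈f v≈w) with root? v | root? w
  -- `root?` could name different indices for equal vertices; distinctness of the roots excludes
  -- this.
  ... | yes (i , p) | yes (j , q) with G.roots-distinct i j (G.≈-trans (G.≈-sym p) (G.≈-trans v≈w q))
  ...   | refl = Pointwise.inj₁ (e≈f i)
  normalForm-glue (copy e≈f v≈w) | yes (i , p) | no ¬q = contradiction (i , G.≈-trans (G.≈-sym v≈w) p) ¬q
  normalForm-glue (copy e≈f v≈w) | no ¬p | yes (j , q) = contradiction (j , G.≈-trans v≈w q) ¬p
  normalForm-glue (copy e≈f v≈w) | no _  | no _        = Pointwise.inj₂ (e≈f , v≈w)
  normalForm-glue (root e i) with root? (G.const i)
  ... | yes (j , p) with G.roots-distinct i j p
  ...   | refl = Pointwise.inj₁ A.≈-refl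
  normalForm-glue (root e i) | no ¬p = contradiction (i , G.≈-refl) ¬p

  -- Invariance under the generators passes to the closure, so no chain of identifications is ever
  -- analysed.
  normalForm-∼ : ∀ {x y} → x ∼ y → normalForm x N.≈ normalForm y
  normalForm-∼ = gfold N.isEquivalence normalForm normalForm-glue

  normalForm-nonroot : ∀ {e v} → ¬ Root v → normalForm (inj₂ (e , v)) ≡ inj₂ (e , v)
  normalForm-nonroot {v = v} ¬root with root? v
  ... | yes p = contradiction p ¬root
  ... | no  _ = refl

  base-injective : ∀ {x y} → inj₁ x ∼ inj₁ y → x A.≈ y
  base-injective p = drop-inj₁ (normalForm-∼ p)

  base≁copy : ∀ {x e v} → ¬ Root v → ¬ (inj₁ x ∼ inj₂ (e , v))
  base≁copy {x} ¬root p with subst (inj₁ x N.≈_) (normalForm-nonroot ¬root) (normalForm-∼ p)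
  ... | ()

  copy-injective : ∀ {e f v w} → ¬ Root v → inj₂ (e , v) ∼ inj₂ (f , w) →
                   (∀ i → proj₁ e i A.≈ proj₁ f i) × v G.≈ w
  copy-injective {w = w} ¬root p with root? w | subst (N._≈ _) (normalForm-nonroot ¬root) (normalForm-∼ p)
  ... | yes _ | ()
  ... | no  _ | Pointwise.inj₂ q = q

  root-of : ∀ {x e v} → inj₁ x ∼ inj₂ (e , v) → ∃[ i ] (v G.≈ G.const i × x A.≈ proj₁ e i)
  root-of {x} {e} {v} p with root? v | normalForm-∼ p
  ... | yes (i , q) | Pointwise.inj₁ e′ = i , q , e′

  ∼-refl : ∀ {x} → x ∼ x
  ∼-refl = reflexive Glue

  ∼-sym : ∀ {x y} → x ∼ y → y ∼ x
  ∼-sym = symmetric Glue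

  ∼-trans : ∀ {x y z} → x ∼ y → y ∼ z → x ∼ z
  ∼-trans = transitive Glue

-- Root classes and the edges of a fragmented base structure

unique-lookup : {A : Set a} {xs : List A} → Unique xs → ∀ {i j} → lookup xs i ≡ lookup xs j → i ≡ j
unique-lookup (_ AllPairs.∷ _) {zero}  {zero}  eq = refl
unique-lookup (x∉ AllPairs.∷ _) {zero}  {suc j} eq = contradiction eq (All.lookup x∉ (∈-lookup j))
unique-lookup (x∉ AllPairs.∷ _) {suc i} {zero}  eq = contradiction (sym eq) (All.lookup x∉ (∈-lookup i))
unique-lookup (_ AllPairs.∷ u) {suc i} {suc j} eq = cong suc (unique-lookup u eq)

module _ {r : ℕ} {σ : Rel (Fin r) s} (π : Classes σ) where
  open Classes π

  X-injective : ∀ i {p q} → lookup (X π i) p ≡ lookup (X π i) q → p ≡ q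
  X-injective (suc i) = unique-lookup (filter⁺ (λ j → class j ≟ i) (allFin⁺ r))

  X-length : ∀ i → length (X π i) ≤ r
  X-length zero    = z≤n
  X-length (suc i) = ℕ.≤-trans (length-filter (λ j → class j ≟ i) (allFin r)) (ℕ.≤-reflexive (length-tabulate {n = r} id))

  X-position : ∀ {i j} → class j ≡ i → ∃[ p ] (lookup (X π (suc i)) p ≡ j)
  X-position {i} {j} eq = let m = ∈-filter⁺ (λ j → class j ≟ i) (∈-allFin j) eq in index m , sym (lookup-index m)

  X-class : ∀ {i} p → class (lookup (X π (suc i)) p) ≡ i
  X-class {i} p = proj₂ (∈-filter⁻ (λ j → class j ≟ i) {xs = allFin r} (∈-lookup p))

  -- The tuple of the only Rᵢ-edge of `Gad`. `view` splits the coordinates as `init` and `last` do.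
  edgeVertex : ∀ i → Vector (GadVertex π) (suc (length (X π i)))
  edgeVertex i p with view p
  ... | ‵fromℕ     = inj₂ i
  ... | ‵inject₁ j = inj₁ (lookup (X π i) j)

  edgeVertex-init : ∀ i j → edgeVertex i (inject₁ j) ≡ inj₁ (lookup (X π i) j)
  edgeVertex-init i j rewrite view-inject₁ j = refl

  edgeVertex-last : ∀ i → last (edgeVertex i) ≡ inj₂ i
  edgeVertex-last i rewrite view-fromℕ (length (X π i)) = refl

  edgeVertex-unique : ∀ (L : Language) i {t} → GadRelation π L (inj₂ i) t → t ≗ edgeVertex i
  edgeVertex-unique L i (roots , aux) p with view p
  ... | ‵fromℕ     = aux
  ... | ‵inject₁ j = roots j

  module Fragment {L : Language} (A : BaseStructure a L r) where
    private
      module A = Structure A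
      module F = Structure (fragment π A)

    isRoot? : (v : GadVertex π) → Dec (∃[ i ] (v ≡ inj₁ i))
    isRoot? (inj₁ i) = yes (i , refl)
    isRoot? (inj₂ i) = no λ ()

    open Charts (expand π A) (Gad π L) isRoot? public
    open GadgetConstruction (expand π A) (Gad π L) public using (Edge; fromBase; fromGadget; root; copy)

    auxiliary-nonroot : ∀ i → ¬ Root (inj₂ i)
    auxiliary-nonroot i ()

    fragmentEdge : (e : Edge) → ∀ i → F.rel (inj₂ i) (λ p → inj₂ (e , edgeVertex i p))
    fragmentEdge e i = fromGadget e (edgeVertex i) (edgeVertex-init i , edgeVertex-last i) (λ p → F.≈-refl)

    -- `expand` has no Rᵢ-tuples and each copy of `Gad` has exactly one.
    fragmentEdge⁻¹ : ∀ {i t} → F.rel (inj₂ i) t → ∃[ e ] (∀ p → inj₂ (e , edgeVertex i p) F.≈ t p)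
    fragmentEdge⁻¹ {i} (fromGadget e v Rv eq) = e , λ p →
      subst (λ u → inj₂ (e , u) F.≈ _) (edgeVertex-unique L i Rv p) (eq p)

    fragmentBase : ∀ {S x t} → A.rel (inj₁ S) x → (∀ i → inj₁ (x i) F.≈ t i) → F.rel (inj₁ S) t
    fragmentBase Sx eq = fromBase _ Sx eq

    fragmentBase⁻¹ : ∀ {S x t} → F.rel (inj₁ S) t → (∀ i → inj₁ (x i) F.≈ t i) → A.rel (inj₁ S) x
    fragmentBase⁻¹ {S} (fromBase y Sy eq) eq′ =
      A.rel-resp (inj₁ S) (λ i → base-injective (F.≈-trans (eq i) (F.≈-sym (eq′ i)))) Sy

-- The same for B ✶[ π ] H.
module PartCharts (em : ExcludedMiddle ℓ) {L : Language} {r : ℕ} {σ : Rel (Fin r) s} (π : Classes σ)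
  (B : Structure ℓ (fragmentLanguage π L) 0) (H : Structure ℓ L r)
  (roots-distinct : ∀ i j → Structure._≈_ H (Structure.const H i) (Structure.const H j) → i ≡ j)
  (separated : ∀ i j → Connected H (Structure.const H i) (Structure.const H j) → Classes.class π i ≡ Classes.class π j) where

  open Classes π
  private
    module B = Structure B
    module H = Structure H
  open FragmentReplacement π B H

  connected-refl : ∀ {x y} → x H.≈ y → Connected H x y
  connected-refl e = 0 , stop e

  walk-respˡ : ∀ {x y z n} → x H.≈ y → Walk H y z n → Walk H x z n
  walk-respˡ e (stop e′) = stop (H.≈-trans e e′)
  walk-respˡ e (step (ne , S , t , St , p , q , tp , tq) w) =
    step (ne ∘ H.≈-trans (H.≈-sym e) , S , t , St , p , q , H.≈-trans tp (H.≈-sym e) , tq) w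

  connected-trans : ∀ {x y z} → Connected H x y → Connected H y z → Connected H x z
  connected-trans (_ , stop e) (_ , w) = _ , walk-respˡ e w
  connected-trans (_ , step a w) c = let n , w′ = connected-trans (_ , w) c in suc n , step a w′

  adjacent-sym : ∀ {x y} → GaifmanAdjacent H x y → GaifmanAdjacent H y x
  adjacent-sym (ne , S , t , St , p , q , tp , tq) = ne ∘ H.≈-sym , S , t , St , q , p , tq , tp

  connected-sym : ∀ {x y} → Connected H x y → Connected H y x
  connected-sym (_ , stop e)   = connected-refl (H.≈-sym e)
  connected-sym (_ , step a w) =
    connected-trans (connected-sym (_ , w)) (1 , step (adjacent-sym a) (stop H.≈-refl))

  -- Gaifman adjacency demands distinct vertices, hence the case distinction.
  related-connected : ∀ {S t} p q → H.rel S t → Connected H (t p) (t q)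
  related-connected {S} {t} p q St with em {t p H.≈ t q}
  ... | yes e = connected-refl e
  ... | no ne = 1 , step (ne , S , t , St , p , q , H.≈-refl , H.≈-refl) (stop H.≈-refl)

  part-exists : ∀ v → ∃[ i ] Part i v
  part-exists v with em {∃[ j ] Connected H (H.const j) v}
  ... | yes (j , c) = suc (class j) , j , refl , c
  ... | no ¬c       = zero , λ j c → ¬c (j , c)

  part-connected : ∀ i {v w} → Connected H v w → Part i v → Part i w
  part-connected zero    c p j c′          = p j (connected-trans c′ (connected-sym c))
  part-connected (suc i) c (j , eq , c′)   = j , eq , connected-trans c′ c

  -- A vertex reached from roots of two classes would connect these roots, against `separated`.
  part-unique : ∀ i i′ {v} → Part i v → Part i′ v → i ≡ i′
  part-unique zero    zero     p q = refl
  part-unique zero    (suc _)  p (j , _ , c) = contradiction c (p j)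
  part-unique (suc _) zero     (j , _ , c) p = contradiction c (p j)
  part-unique (suc i) (suc i′) (j , eq , c) (j′ , eq′ , c′) =
    cong suc (trans (sym eq) (trans (separated j j′ (connected-trans c (connected-sym c′))) eq′))

  -- By `separated`, a root in part i belongs to `X π i`. So every root in a copy of a part is glued
  -- to B, and exactly the non-root vertices are new.
  part-root : ∀ i {v j} → Part i v → v H.≈ H.const j → ∃[ p ] (lookup (X π i) p ≡ j)
  part-root zero    {j = j} part e = contradiction (connected-refl (H.≈-sym e)) (part j)
  part-root (suc i) {j = j} (j′ , eq , c) e =
    X-position π (trans (separated j j′ (connected-sym (connected-trans c (connected-refl e)))) eq)

  Root : H.Carrier → Set ℓ
  Root v = ∃[ j ] (v H.≈ H.const j)

  RootIn : Fin (suc count) → H.Carrier → Set ℓ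
  RootIn i v = ∃[ p ] (v H.≈ H.const (lookup (X π i) p))

  rootIn : ∀ i {v} → Part i v → Root v → RootIn i v
  rootIn i part (j , e) with part-root i part e
  ... | p , refl = p , e

  -- Vertices of different parts have different types; as an inductive family, `ChartEq` yields
  -- equality of the two indices by matching.
  data ChartEq : Rel (∃[ i ] (Edge i × PartVertex i)) ℓ where
    chartEq : ∀ {i} {e f : Edge i} {v w : PartVertex i} →
              (∀ j → proj₁ e j B.≈ proj₁ f j) → proj₁ v H.≈ proj₁ w → ChartEq (i , e , v) (i , f , w)

  chartSetoid : Setoid ℓ ℓ
  chartSetoid = record
    { _≈_ = ChartEq
    ; isEquivalence = record
      { refl  = chartEq (λ _ → B.≈-refl) H.≈-refl
      ; sym   = λ { (chartEq p q) → chartEq (B.≈-sym ∘ p) (H.≈-sym q) }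
      ; trans = λ { (chartEq p q) (chartEq p′ q′) → chartEq (λ j → B.≈-trans (p j) (p′ j)) (H.≈-trans q q′) } } }

  normalSetoid : Setoid ℓ ℓ
  normalSetoid = ⊎-setoid B.universe chartSetoid

  private
    module N = Setoid normalSetoid

  normalForm : Vertex → N.Carrier
  normalForm (inj₁ x) = inj₁ (proj₁ x)
  normalForm (inj₂ (i , e , v)) with em {RootIn i (proj₁ v)}
  ... | yes (p , _) = inj₁ (init (proj₁ e) p)
  ... | no  _       = inj₂ (i , e , v)

  normalForm-glue : ∀ {x y} → Glue x y → normalForm x N.≈ normalForm y
  normalForm-glue (base p) = Pointwise.inj₁ p
  normalForm-glue (copy {i} {e} {f} {v} {w} e≈f v≈w) with em {RootIn i (proj₁ v)} | em {RootIn i (proj₁ w)}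
  ... | yes (p , x) | yes (q , y)
    with X-injective π i (roots-distinct _ _ (H.≈-trans (H.≈-sym x) (H.≈-trans v≈w y)))
  ...   | refl = Pointwise.inj₁ (e≈f (inject₁ p))
  normalForm-glue (copy e≈f v≈w) | yes (i , p) | no ¬q = contradiction (i , H.≈-trans (H.≈-sym v≈w) p) ¬q
  normalForm-glue (copy e≈f v≈w) | no ¬p | yes (j , q) = contradiction (j , H.≈-trans v≈w q) ¬p
  normalForm-glue (copy e≈f v≈w) | no _  | no _        = Pointwise.inj₂ (chartEq e≈f v≈w)
  normalForm-glue (root {x} {i} {e} {v} p x≈ v≈) with em {RootIn i (proj₁ v)}
  ... | yes (q , y) with X-injective π i (roots-distinct _ _ (H.≈-trans (H.≈-sym v≈) y))
  ...   | refl = Pointwise.inj₁ x≈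
  normalForm-glue (root p x≈ v≈) | no ¬p = contradiction (p , v≈) ¬p

  normalForm-∼ : ∀ {x y} → x ∼ y → normalForm x N.≈ normalForm y
  normalForm-∼ = gfold N.isEquivalence normalForm normalForm-glue

  normalForm-nonroot : ∀ {i e v} → ¬ Root (proj₁ v) → normalForm (inj₂ (i , e , v)) ≡ inj₂ (i , e , v)
  normalForm-nonroot {i} {v = v} ¬root with em {RootIn i (proj₁ v)}
  ... | yes (p , q) = contradiction (_ , q) ¬root
  ... | no  _       = refl

  base-injective : ∀ {x y} → inj₁ x ∼ inj₁ y → proj₁ x B.≈ proj₁ y
  base-injective p = drop-inj₁ (normalForm-∼ p)

  base≁copy : ∀ {x i e v} → ¬ Root (proj₁ v) → ¬ (inj₁ x ∼ inj₂ (i , e , v))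
  base≁copy {x} ¬root p with subst (inj₁ (proj₁ x) N.≈_) (normalForm-nonroot ¬root) (normalForm-∼ p)
  ... | ()

  copy-injective : ∀ {i e v j f w} → ¬ Root (proj₁ v) → inj₂ (i , e , v) ∼ inj₂ (j , f , w) →
                   ChartEq (i , e , v) (j , f , w)
  copy-injective {j = j} {w = w} ¬root p
    with em {RootIn j (proj₁ w)} | subst (N._≈ _) (normalForm-nonroot ¬root) (normalForm-∼ p)
  ... | yes _ | ()
  ... | no  _ | Pointwise.inj₂ q = q

  root-of : ∀ {x i e v} → inj₁ x ∼ inj₂ (i , e , v) →
            ∃[ p ] (proj₁ v H.≈ H.const (lookup (X π i) p) × proj₁ x B.≈ init (proj₁ e) p)
  root-of {x} {i} {e} {v} p with em {RootIn i (proj₁ v)} | normalForm-∼ p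
  ... | yes (i , q) | Pointwise.inj₁ e′ = i , q , e′

  ∼-refl : ∀ {x} → x ∼ x
  ∼-refl = reflexive Glue

  ∼-sym : ∀ {x y} → x ∼ y → y ∼ x
  ∼-sym = symmetric Glue

  ∼-trans : ∀ {x y z} → x ∼ y → y ∼ z → x ∼ z
  ∼-trans = transitive Glue

-- Composition of winning strategies

module Composition (em : ExcludedMiddle ℓ) {L : Language} (positive : PositiveArities L) {r : ℕ}
  {σ : Rel (Fin r) s} (π : Classes σ) (A : BaseStructure ℓ L r) (G : Gadget ℓ L r)
  (B : Structure ℓ (fragmentLanguage π L) 0) (H : Structure ℓ L r)
  (roots-distinct : ∀ i j → Structure._≈_ H (Structure.const H i) (Structure.const H j) → i ≡ j)
  (separated : ∀ i j → Connected H (Structure.const H i) (Structure.const H j) → Classes.class π i ≡ Classes.class π j) where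

  open Classes π
  private
    AS = fragment π A
    GS = Gadget.structure G
    module A  = Structure A
    module B  = Structure B
    module G  = Structure GS
    module H  = Structure H
    module AS = Structure AS
    module F  = Fragment π A
    module C  = Charts A G (λ _ → em)
    module D  = PartCharts em π B H roots-distinct separated
    module 𝒞  = GadgetConstruction A G
    module 𝒟  = FragmentReplacement π B H
    module P  = Game AS B
    module Γ  = Game GS H
  open 𝒞 using (_∼_)
  open 𝒟 using (IsAuxiliary; Part) renaming (_∼_ to _∼′_)

  -- The number of vertices of `Gad`: r roots, and one auxiliary vertex for X₀ and for each class.
  rounds : ℕ
  rounds = r + suc count

  _≈ᵉ_ : F.Edge → F.Edge → Set ℓ
  e ≈ᵉ f = ∀ j → proj₁ e j A.≈ proj₁ f j

  -- An edge of A together with the answers in B to its vertices in fragment π A.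
  record MatchedEdge : Set ℓ where
    field
      edge   : F.Edge
      answer : GadVertex π → B.Carrier
      isEdge : ∀ i → B.rel (inj₂ i) (answer ∘ edgeVertex π i)

    partEdge : ∀ i → 𝒟.Edge i
    partEdge i = answer ∘ edgeVertex π i , isEdge i

  open MatchedEdge

  record State : Set (lsuc ℓ) where
    field
      P       : P.Position
      Index   : Set ℓ
      matched : Index → MatchedEdge
      Γ       : Index → Γ.Position

  open State

  -- `distinct` allows one game per edge, so that any two vertices in one copy of G are compared
  -- within a single position. `winsInit` is the unplayed game with which a newly touched edge
  -- starts.
  record Winning (S : State) (p g : ℕ) : Set ℓ where
    field
      wins      : Wins AS B (P S) p
      answers   : ∀ s v → P S (inj₂ (edge (matched S s) , v)) (answer (matched S s) v)
      distinct  : ∀ s t → edge (matched S s) ≈ᵉ edge (matched S t) → s ≡ t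
      winsΓ     : ∀ s → Wins GS H (Γ S s) g
      constΓ    : ∀ s c → Γ S s (G.const c) (H.const c)
      winsInit  : Wins GS H (constants GS H) g

  open Winning

  -- `inBase` covers the roots of copies as well, and `inEdge` only non-root vertices, so the two
  -- cases never describe the same vertex. In `inBase` the recorded x may be a root inside a copy of
  -- `Gad`; a is the vertex of A equal to it.
  data Represents (S : State) (c : 𝒞.Vertex) (d : 𝒟.Vertex) : Set ℓ where
    inBase : ∀ {a x y} b → P S x y → inj₁ a AS.≈ x → proj₁ b B.≈ y → inj₁ a ∼ c → inj₁ b ∼′ d → Represents S c d
    inEdge : ∀ s i {v} w → Γ S s v (proj₁ w) → ¬ C.Root v →
             inj₂ (edge (matched S s) , v) ∼ c → inj₂ (i , partEdge (matched S s) i , w) ∼′ d → Represents S c d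

  _≼_ : State → State → Set ℓ
  S ≼ T = ∀ {c d} → Represents S c d → Represents T c d

  -- Every gadget position contains the constants, hence equality with a root is preserved.
  nonroot : ∀ {S p g} → Winning S p g → ∀ s {v w} → Γ S s v w → ¬ C.Root v → ¬ D.Root w
  nonroot W s γ ¬v (j , w≈) = ¬v (j , from (eq-iff (atomic GS H (winsΓ W s)) γ (constΓ W s j)) w≈)

  nonroot⁻¹ : ∀ {S p g} → Winning S p g → ∀ s {v w} → Γ S s v w → ¬ D.Root w → ¬ C.Root v
  nonroot⁻¹ W s γ ¬w (j , v≈) = ¬w (j , to (eq-iff (atomic GS H (winsΓ W s)) γ (constΓ W s j)) v≈)

  Represents-resp : ∀ {S c c′ d d′} → c ∼ c′ → d ∼′ d′ → Represents S c d → Represents S c′ d′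
  Represents-resp p q (inBase b pxy e f p′ q′)  = inBase b pxy e f (C.∼-trans p′ p) (D.∼-trans q′ q)
  Represents-resp p q (inEdge s i w γ ¬v p′ q′) = inEdge s i w γ ¬v (C.∼-trans p′ p) (D.∼-trans q′ q)

  spend : ∀ {S p p′ g} → p′ ≤ p → Winning S p g → Winning S p′ g
  spend le W = record
    { wins = lower le (wins W) ; answers = answers W ; distinct = distinct W
    ; winsΓ = winsΓ W ; constΓ = constΓ W ; winsInit = winsInit W }

  spendΓ : ∀ {S p g} → Winning S p (suc g) → Winning S p g
  spendΓ W = record
    { wins = wins W ; answers = answers W ; distinct = distinct W
    ; winsΓ = lower (ℕ.n≤1+n _) ∘ winsΓ W ; constΓ = constΓ W ; winsInit = lower (ℕ.n≤1+n _) (winsInit W) }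

  withP : State → P.Position → State
  withP S P′ = record { P = P′ ; Index = Index S ; matched = matched S ; Γ = Γ S }

  module _ {S : State} {P′ : P.Position} (P⊆P′ : ∀ {x y} → P S x y → P′ x y) where

    withP-≼ : S ≼ withP S P′
    withP-≼ (inBase b pxy e f p q)  = inBase b (P⊆P′ pxy) e f p q
    withP-≼ (inEdge s i w γ ¬v p q) = inEdge s i w γ ¬v p q

    withP-winning : ∀ {p p′ g} → Winning S p g → Wins AS B P′ p′ → Winning (withP S P′) p′ g
    withP-winning W w = record
      { wins = w ; answers = λ s v → P⊆P′ (answers W s v) ; distinct = distinct W
      ; winsΓ = winsΓ W ; constΓ = constΓ W ; winsInit = winsInit W }

  edge-forth : ∀ {P p} → Wins AS B P (rounds + p) → (e : F.Edge) →
    ∃[ P′ ] (Wins AS B P′ p × (∀ {x y} → P x y → P′ x y) ×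
      ∃[ m ] (edge m ≡ e × (∀ v → P′ (inj₂ (e , v)) (answer m v))))
  edge-forth {p = p} w e =
    let y , w₁ = forths r (lower (ℕ.≤-reflexive (sym (ℕ.+-assoc r (suc count) p))) w) (λ j → inj₂ (e , inj₁ j))
        z , w₂ = forths (suc count) w₁ (λ i → inj₂ (e , inj₂ i))
        rel : ∀ v → _
        rel = λ { (inj₁ j) → inj₁ (inj₂ (j , AS.≈-refl , B.≈-refl)) ; (inj₂ i) → inj₂ (i , AS.≈-refl , B.≈-refl) }
        ans = [ y , z ]′
    in _ , w₂ , inj₁ ∘ inj₁
       , record { edge = e ; answer = ans
                ; isEdge = λ i → to (rel-iff (atomic AS B w₂) (inj₂ i) {u = ans ∘ edgeVertex π i}
                                     (λ p → rel (edgeVertex π i p)))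
                                   (F.fragmentEdge e i) }
       , refl , rel

  -- The reply to an Rᵢ-edge is an Rᵢ-edge of `fragment π A`, which lies in a copy of `Gad`. It has
  -- at most r + 1 vertices.
  edge-back : ∀ {P p q} → suc r + q ≤ p → Wins AS B P p → ∀ {i} (e′ : 𝒟.Edge i) →
    ∃[ t ] (Wins AS B (P P.▷▷ (t , proj₁ e′)) q × ∃[ e ] (∀ p → inj₂ (e , edgeVertex π i p) AS.≈ t p))
  edge-back {q = q} le w {i} (e′ , Re′) =
    let t , w′ = backs _ (lower (ℕ.≤-trans (s≤s (ℕ.+-monoˡ-≤ q (X-length π i))) le) w) e′
    in t , w′ , F.fragmentEdge⁻¹ (from (rel-iff (atomic AS B w′) (inj₂ i) (λ p → inj₂ (p , AS.≈-refl , B.≈-refl))) Re′)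

  edgeVertex-lastE : ∀ (e : F.Edge) i → inj₂ (e , last (edgeVertex π i)) AS.≈ inj₂ (e , inj₂ i)
  edgeVertex-lastE e i = subst (λ v → inj₂ (e , last (edgeVertex π i)) AS.≈ inj₂ (e , v)) (edgeVertex-last π i) AS.≈-refl

  rootE : ∀ (e : F.Edge) j → inj₁ (proj₁ e j) AS.≈ inj₂ (e , inj₁ j)
  rootE e j = return (F.root e j)

  -- If z ended an Rᵢ-edge of B, playing this edge back would make a equal to an auxiliary vertex of
  -- `fragment π A`, which is never a vertex of A.
  nonauxiliary : ∀ {P p a x y z} → suc r ≤ p → Wins AS B P p → P x y → inj₁ a AS.≈ x → z B.≈ y → ¬ IsAuxiliary z
  nonauxiliary {P} {p} le w pxy a≈x z≈y (i , t′ , Rt′ , last≈z) =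
    let t , w′ , e , e≈t = edge-back {P} {q = 0} (subst (_≤ p) (sym (ℕ.+-identityʳ (suc r))) le) w {i} (t′ , Rt′)
        x≈last = from (eq-iff (atomic AS B w′) (inj₁ pxy) (inj₂ (fromℕ _ , AS.≈-refl , B.≈-refl)))
                      (B.≈-trans (B.≈-sym z≈y) (B.≈-sym last≈z))
    in F.base≁copy {e = e} (F.auxiliary-nonroot i)
         (AS.≈-trans a≈x (AS.≈-trans x≈last (AS.≈-trans (AS.≈-sym (e≈t (fromℕ _))) (edgeVertex-lastE e i))))

  copyE : ∀ {e f : F.Edge} v → e ≈ᵉ f → inj₂ (e , v) AS.≈ inj₂ (f , v)
  copyE v e≈f = return (F.copy e≈f refl)

  -- Auxiliary vertices are not glued, so one of them determines all of e, including the vertices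
  -- outside the class i.
  copyE⁻¹ : ∀ {e f : F.Edge} i → inj₂ (e , last (edgeVertex π i)) AS.≈ inj₂ (f , last (edgeVertex π i)) → e ≈ᵉ f
  copyE⁻¹ {e} {f} i p = proj₁ (F.copy-injective {e = e} {f = f} (F.auxiliary-nonroot i)
    (AS.≈-trans (AS.≈-sym (edgeVertex-lastE e i)) (AS.≈-trans p (edgeVertex-lastE f i))))

  addEdge : State → P.Position → MatchedEdge → State
  addEdge S P′ m = record
    { P       = P′
    ; Index   = Maybe (Index S)
    ; matched = λ { nothing → m ; (just s) → matched S s }
    ; Γ       = λ { nothing → constants GS H ; (just s) → Γ S s } }

  ensureEdge : ∀ {S p g} → Winning S (rounds + p) g → (e : F.Edge) →
    ∃[ T ] (Winning T p g × S ≼ T × (∀ {x y} → P S x y → P T x y) × ∃[ s ] (e ≈ᵉ edge (matched T s)))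
  ensureEdge {S} {p} {g} W e with em {∃[ s ] (e ≈ᵉ edge (matched S s))}
  ... | yes found = S , spend (ℕ.m≤n+m p rounds) W , id , id , found
  ... | no ¬found with edge-forth (wins W) e
  ...   | P′ , w , P⊆P′ , m , refl , rel = addEdge S P′ m , W′ , mono , P⊆P′ , nothing , λ _ → A.≈-refl
    where
    mono : S ≼ addEdge S P′ m
    mono (inBase b pxy e f p q)  = inBase b (P⊆P′ pxy) e f p q
    mono (inEdge s i w γ ¬v p q) = inEdge (just s) i w γ ¬v p q

    W′ : Winning (addEdge S P′ m) p g
    W′ .wins = w
    W′ .answers nothing  v = rel v
    W′ .answers (just s) v = P⊆P′ (answers W s v)
    W′ .distinct nothing  nothing  _ = refl
    W′ .distinct nothing  (just t) q = contradiction (t , q) ¬found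
    W′ .distinct (just s) nothing  q = contradiction (s , A.≈-sym ∘ q) ¬found
    W′ .distinct (just s) (just t) q = cong just (distinct W s t q)
    W′ .winsΓ nothing  = winsInit W
    W′ .winsΓ (just s) = winsΓ W s
    W′ .constΓ nothing  c = c , G.≈-refl , H.≈-refl
    W′ .constΓ (just s) c = constΓ W s c
    W′ .winsInit = winsInit W

  -- One Rᵢ-edge played back from B, followed by a full copy of `Gad`.
  cost : ℕ
  cost = suc r + rounds

  -- Once the edge of A behind e′ is matched, its stored answer on part i coincides with e′, since
  -- both answer the same vertices.
  ensurePart : ∀ {S p g} → Winning S (cost + p) g → ∀ {i} (e′ : 𝒟.Edge i) →
    ∃[ T ] (Winning T p g × S ≼ T × ∃[ s ] (∀ q → proj₁ e′ q B.≈ answer (matched T s) (edgeVertex π i q)))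
  ensurePart {S} {p} W {i} e′ =
    let t , w , e , e≈t = edge-back {q = rounds + p} (ℕ.≤-reflexive (sym (ℕ.+-assoc (suc r) rounds p))) (wins W) e′
        T , W′ , S≼T , P⊆ , s , e≈s = ensureEdge (withP-winning {S} inj₁ W w) e
    in T , W′ , (λ x → S≼T (withP-≼ {S} inj₁ x)) , s , λ q →
       to (eq-iff (atomic AS B (wins W′)) (P⊆ (inj₂ (q , AS.≈-refl , B.≈-refl))) (answers W′ s (edgeVertex π i q)))
          (AS.≈-trans (AS.≈-sym (e≈t q)) (copyE (edgeVertex π i q) e≈s))

  same-edge : ∀ {S p g} (W : Winning S p g) {s t i} →
    answer (matched S s) (last (edgeVertex π i)) B.≈ answer (matched S t) (last (edgeVertex π i)) → s ≡ t
  same-edge W {s} {t} {i} e =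
    distinct W s t (copyE⁻¹ i (from (eq-iff (atomic AS B (wins W)) (answers W s _) (answers W t _)) e))

  same⇒ : ∀ {S p g} → Winning S p g → ∀ {c d c′ d′} → Represents S c d → Represents S c′ d′ → c ∼ c′ → d ∼′ d′
  same⇒ W (inBase b pxy a≈x b≈y p q) (inBase b′ pxy′ a≈x′ b≈y′ p′ q′) e =
    let a≈a′ = C.base-injective (C.∼-trans p (C.∼-trans e (C.∼-sym p′)))
        y≈y′ = to (eq-iff (atomic AS B (wins W)) pxy pxy′)
                  (AS.≈-trans (AS.≈-sym a≈x) (AS.≈-trans (return (GadgetConstruction.base a≈a′)) a≈x′))
    in D.∼-trans (D.∼-sym q) (D.∼-trans (return (𝒟.base (B.≈-trans b≈y (B.≈-trans y≈y′ (B.≈-sym b≈y′))))) q′)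
  same⇒ W (inBase _ _ _ _ p _) (inEdge _ _ _ _ ¬v p′ _) e =
    contradiction (C.∼-trans p (C.∼-trans e (C.∼-sym p′))) (C.base≁copy ¬v)
  same⇒ W (inEdge _ _ _ _ ¬v p _) (inBase _ _ _ _ p′ _) e =
    contradiction (C.∼-trans p′ (C.∼-trans (C.∼-sym e) (C.∼-sym p))) (C.base≁copy ¬v)
  same⇒ W (inEdge s i w γ ¬v p q) (inEdge s′ i′ w′ γ′ ¬v′ p′ q′) e
    with C.copy-injective ¬v (C.∼-trans p (C.∼-trans e (C.∼-sym p′)))
  ... | e≈e′ , v≈v′ with distinct W s s′ e≈e′
  ...   | refl with to (eq-iff (atomic GS H (winsΓ W s)) γ γ′) v≈v′
  -- Equal vertices of H lie in one part, so both pairs use the same Rᵢ-edge.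
  ...     | w≈w′ with D.part-unique i i′ (D.part-connected i (D.connected-refl w≈w′) (proj₂ w)) (proj₂ w′)
  ...       | refl = D.∼-trans (D.∼-sym q) (D.∼-trans (return (𝒟.copy (λ _ → B.≈-refl) w≈w′)) q′)

  same⇐ : ∀ {S p g} → Winning S p g → ∀ {c d c′ d′} → Represents S c d → Represents S c′ d′ → d ∼′ d′ → c ∼ c′
  same⇐ W (inBase b pxy a≈x b≈y p q) (inBase b′ pxy′ a≈x′ b≈y′ p′ q′) e =
    let b≈b′ = D.base-injective (D.∼-trans q (D.∼-trans e (D.∼-sym q′)))
        x≈x′ = from (eq-iff (atomic AS B (wins W)) pxy pxy′)
                    (B.≈-trans (B.≈-sym b≈y) (B.≈-trans b≈b′ b≈y′))
        a≈a′ = F.base-injective (AS.≈-trans a≈x (AS.≈-trans x≈x′ (AS.≈-sym a≈x′)))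
    in C.∼-trans (C.∼-sym p) (C.∼-trans (return (𝒞.base a≈a′)) p′)
  same⇐ W (inBase _ _ _ _ _ q) (inEdge s i w γ ¬v _ q′) e =
    contradiction (D.∼-trans q (D.∼-trans e (D.∼-sym q′))) (D.base≁copy (nonroot W s γ ¬v))
  same⇐ W (inEdge s i w γ ¬v _ q) (inBase _ _ _ _ _ q′) e =
    contradiction (D.∼-trans q′ (D.∼-trans (D.∼-sym e) (D.∼-sym q))) (D.base≁copy (nonroot W s γ ¬v))
  same⇐ W (inEdge s i w γ ¬v p q) (inEdge s′ i′ w′ γ′ ¬v′ p′ q′) e
    with D.copy-injective (nonroot W s γ ¬v) (D.∼-trans q (D.∼-trans e (D.∼-sym q′)))
  -- The last coordinate, the auxiliary vertex, already identifies the edge.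
  ... | D.chartEq e≈e′ w≈w′ with same-edge W (e≈e′ (fromℕ _))
  ...   | refl = C.∼-trans (C.∼-sym p)
      (C.∼-trans (return (𝒞.copy (λ _ → A.≈-refl) (from (eq-iff (atomic GS H (winsΓ W s)) γ γ′) w≈w′))) p′)

  onBase : ∀ {S c d x} → Represents S c d → inj₁ x ∼ c →
    ∃[ z ] ∃[ y ] ∃[ b ] (P S z y × inj₁ x AS.≈ z × proj₁ b B.≈ y × inj₁ b ∼′ d)
  onBase (inBase b pxy a≈x b≈y p q) e =
    _ , _ , b , pxy , AS.≈-trans (return (GadgetConstruction.base (C.base-injective (C.∼-trans e (C.∼-sym p))))) a≈x , b≈y , q
  onBase (inEdge _ _ _ _ ¬v p _) e = contradiction (C.∼-trans e (C.∼-sym p)) (C.base≁copy ¬v)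

  onBase′ : ∀ {S p g c d b} → Winning S p g → Represents S c d → inj₁ b ∼′ d →
    ∃[ z ] ∃[ y ] ∃[ a ] (P S z y × inj₁ a AS.≈ z × proj₁ b B.≈ y × inj₁ a ∼ c)
  onBase′ W (inBase {a} b pxy a≈x b≈y p q) e =
    _ , _ , a , pxy , a≈x , B.≈-trans (D.base-injective (D.∼-trans e (D.∼-sym q))) b≈y , p
  onBase′ W (inEdge s _ _ γ ¬v _ q) e =
    contradiction (D.∼-trans e (D.∼-sym q)) (D.base≁copy (nonroot W s γ ¬v))

  copy-root : ∀ {e v j} → v G.≈ G.const j → inj₁ (proj₁ e j) ∼ inj₂ (e , v)
  copy-root {e} {v} {j} v≈ = C.∼-trans (return (𝒞.root e j)) (return (𝒞.copy (λ _ → A.≈-refl) (G.≈-sym v≈)))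

  -- A vertex of A in the copy of e is one of its roots and has the constant as its partner in H.
  -- The conclusion covers every part containing w, because `rel⇒` fixes the part only after the
  -- whole tuple has been collected.
  onEdge : ∀ {S p g c d e v} (W : Winning S p g) s → e ≈ᵉ edge (matched S s) → Represents S c d → inj₂ (e , v) ∼ c →
    ∃[ v′ ] ∃[ w ] (v G.≈ v′ × Γ S s v′ w × (∀ i part → inj₂ (i , partEdge (matched S s) i , (w , part)) ∼′ d))
  onEdge {S} {e = e} W s e≈ (inBase {a} {x} b pxy a≈x b≈y p q) v∼ with C.root-of (C.∼-trans p (C.∼-sym v∼))
  ... | j , v≈ , a≈e = G.const j , H.const j , v≈ , constΓ W s j , glue
    where
    m = matched S s

    y≈ : B._≈_ (proj₁ b) (answer m (inj₁ j))
    y≈ = B.≈-trans b≈y (to (eq-iff (atomic AS B (wins W)) pxy (answers W s (inj₁ j)))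
           (AS.≈-trans (AS.≈-sym a≈x) (AS.≈-trans (return (GadgetConstruction.base (A.≈-trans a≈e (e≈ j)))) (rootE (edge m) j))))

    glue : ∀ i part → inj₂ (i , partEdge m i , (H.const j , part)) ∼′ _
    glue i part with D.part-root i part H.≈-refl
    ... | k , refl = D.∼-trans (D.∼-sym (return (𝒟.root k
            (subst (λ u → proj₁ b B.≈ answer m u) (sym (edgeVertex-init π i k)) y≈) H.≈-refl))) q
  onEdge {S} W s e≈ (inEdge t i (w , part) γ ¬v p q) v∼ with C.copy-injective ¬v (C.∼-trans p (C.∼-sym v∼))
  ... | et≈e , v′≈v with distinct W t s (λ j → A.≈-trans (et≈e j) (e≈ j))
  ...   | refl = _ , w , G.≈-sym v′≈v , γ , glue
    where
    glue : ∀ i′ part′ → inj₂ (i′ , partEdge (matched S s) i′ , (w , part′)) ∼′ _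
    glue i′ part′ with D.part-unique i i′ part part′
    ... | refl = D.∼-trans (return (𝒟.copy (λ _ → B.≈-refl) H.≈-refl)) q

  onEdge′ : ∀ {S p g c d i e′ w} (W : Winning S p g) s →
    (∀ q → proj₁ e′ q B.≈ answer (matched S s) (edgeVertex π i q)) → Represents S c d → inj₂ (i , e′ , w) ∼′ d →
    ∃[ v ] ∃[ w′ ] (proj₁ w H.≈ w′ × Γ S s v w′ × inj₂ (edge (matched S s) , v) ∼ c)
  onEdge′ {S} {i = i} {e′} W s e′≈ (inBase {a} b pxy a≈x b≈y p q) w∼ with D.root-of (D.∼-trans q (D.∼-sym w∼))
  ... | k , w≈ , b≈e′ = G.const j , H.const j , w≈ , constΓ W s j ,
      C.∼-trans (C.∼-sym (return (𝒞.root (edge m) j))) (C.∼-trans (return (𝒞.base (A.≈-sym a≈e))) p)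
    where
    j = lookup (X π i) k
    m = matched S s

    y≈ : proj₁ b B.≈ answer m (inj₁ j)
    y≈ = subst (λ u → proj₁ b B.≈ answer m u) (edgeVertex-init π i k) (B.≈-trans b≈e′ (e′≈ (inject₁ k)))

    a≈e : a A.≈ proj₁ (edge m) j
    a≈e = F.base-injective (AS.≈-trans a≈x (AS.≈-trans
            (from (eq-iff (atomic AS B (wins W)) pxy (answers W s (inj₁ j))) (B.≈-trans (B.≈-sym b≈y) y≈))
            (AS.≈-sym (rootE (edge m) j))))
  onEdge′ W s e′≈ (inEdge t i (w , part) γ ¬v p q) w∼
    with D.copy-injective (nonroot W t γ ¬v) (D.∼-trans q (D.∼-sym w∼))
  ... | D.chartEq et≈e′ w′≈w with same-edge W (B.≈-trans (et≈e′ (fromℕ _)) (e′≈ (fromℕ _)))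
  ...   | refl = _ , w , H.≈-sym w′≈w , γ , p

  -- A tuple of H lies in a single component; this coordinate is where the component is looked up.
  position : ∀ S → Fin (arity L S)
  position S with arity L S | positive S
  ... | suc _ | _ = zero

  -- If the tuple from the copy of e consists of roots, e may be untouched. The reserve of rounds
  -- opens its game before the relation is transferred.
  rel⇒ : ∀ {S p g} → Winning S (cost + p) g → ∀ R {t u} → (∀ i → Represents S (t i) (u i)) →
         𝒞.Relation R t → 𝒟.Relation R u
  rel⇒ W R reps (𝒞.fromBase x Rx x∼t) =
    let f i = onBase (reps i) (x∼t i)
        Rz  = F.fragmentBase {t = proj₁ ∘ f} Rx (λ i → let _ , _ , _ , _ , e , _ = f i in e)
        Ry  = to (rel-iff (atomic AS B (wins W)) (inj₁ R) (λ i → let _ , _ , _ , p , _ = f i in p)) Rz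
    in 𝒟.fromBase (λ i → let _ , _ , b , _ = f i in b)
         (B.rel-resp (inj₁ R) (λ i → let _ , _ , _ , _ , _ , e , _ = f i in B.≈-sym e) Ry)
         (λ i → let _ , _ , _ , _ , _ , _ , q = f i in q)
  rel⇒ {p = p} W R reps (𝒞.fromGadget e v Rv v∼t) =
    let T , W′ , S≼T , _ , s , e≈ = ensureEdge {p = 0}
          (spend (ℕ.≤-trans (ℕ.+-monoˡ-≤ 0 (ℕ.m≤n+m rounds (suc r))) (ℕ.+-monoʳ-≤ cost z≤n)) W) e
        f i  = onEdge W′ s e≈ (S≼T (reps i)) (v∼t i)
        w i  = proj₁ (proj₂ (f i))
        Rw   = to (rel-iff (atomic GS H (winsΓ W′ s)) R (λ i → let _ , _ , _ , γ , _ = f i in γ))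
                  (G.rel-resp R (λ i → let _ , _ , v≈ , _ = f i in v≈) Rv)
        k , part₀ = D.part-exists (w (position R))
        part i = D.part-connected k (D.related-connected (position R) i Rw) part₀
    in 𝒟.fromPart k (partEdge (matched T s) k) (λ i → w i , part i) Rw
         (λ i → let _ , _ , _ , _ , q = f i in q k (part i))

  rel⇐ : ∀ {S p g} → Winning S (cost + p) g → ∀ R {t u} → (∀ i → Represents S (t i) (u i)) →
         𝒟.Relation R u → 𝒞.Relation R t
  rel⇐ W R reps (𝒟.fromBase x Rx x∼u) =
    let f i = onBase′ W (reps i) (x∼u i)
        Ry  = B.rel-resp (inj₁ R) (λ i → let _ , _ , _ , _ , _ , e , _ = f i in e) Rx
        Rz  = from (rel-iff (atomic AS B (wins W)) (inj₁ R) (λ i → let _ , _ , _ , p , _ = f i in p)) Ry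
    in 𝒞.fromBase (λ i → let _ , _ , a , _ = f i in a)
         (F.fragmentBase⁻¹ Rz (λ i → let _ , _ , _ , _ , e , _ = f i in e))
         (λ i → let _ , _ , _ , _ , _ , _ , q = f i in q)
  rel⇐ {p = p} W R reps (𝒟.fromPart k e′ w Rw w∼u) =
    let T , W′ , S≼T , s , e′≈ = ensurePart W e′
        f i = onEdge′ W′ s e′≈ (S≼T (reps i)) (w∼u i)
        Rv  = from (rel-iff (atomic GS H (winsΓ W′ s)) R (λ i → let _ , _ , _ , γ , _ = f i in γ))
                   (H.rel-resp R (λ i → let _ , _ , w≈ , _ = f i in w≈) Rw)
    in 𝒞.fromGadget (edge (matched T s)) (proj₁ ∘ f) Rv (λ i → let _ , _ , _ , _ , q = f i in q)

  represents-atomic : ∀ {S p g} → Winning S (cost + p) g → Atomic (A ✶ G) (B ✶[ π ] H) (Represents S)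
  represents-atomic W .eq-iff  x y  = mk⇔ (same⇒ W x y) (same⇐ W x y)
  represents-atomic W .rel-iff R xs = mk⇔ (rel⇒ W R xs) (rel⇐ W R xs)

  play-base : ∀ {S p g} → cost ≤ p → Winning S (suc p) g → ∀ a →
    ∃[ d ] ∃[ T ] (Winning T p g × S ≼ T × Represents T (inj₁ a) d)
  play-base {S} {p} le W a =
    let y , w = forth (wins W) (inj₁ a)
        p≈ = inj₂ (AS.≈-refl , B.≈-refl)
        b  = y , nonauxiliary (ℕ.≤-trans (ℕ.m≤m+n (suc r) rounds) le) w p≈ AS.≈-refl B.≈-refl
    in inj₁ b , _ , withP-winning {S} inj₁ W w , withP-≼ {S} inj₁ , inBase b p≈ AS.≈-refl B.≈-refl C.∼-refl D.∼-refl

  -- With `t ≡ s` inside the position, equality of indices is decided only in the proof that the new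
  -- state is winning.
  addPair : (S : State) → Index S → G.Carrier → H.Carrier → State
  addPair S s v w = record
    { P = P S ; Index = Index S ; matched = matched S
    ; Γ = λ t x y → Γ S t x y ⊎ (t ≡ s × x G.≈ v × y H.≈ w) }

  addPair-≼ : ∀ {S s v w} → S ≼ addPair S s v w
  addPair-≼ (inBase b pxy e f p q)  = inBase b pxy e f p q
  addPair-≼ (inEdge s i w γ ¬v p q) = inEdge s i w (inj₁ γ) ¬v p q

  addPair-winning : ∀ {S s v w p g} → Winning S p (suc g) → Wins GS H (Γ S s Γ.▷ (v , w)) g →
                    Winning (addPair S s v w) p g
  addPair-winning {S} {s} {v} {w} {p} {g} W win = record
    { wins = wins W ; answers = answers W ; distinct = distinct W
    ; winsΓ = winsΓ′ ; constΓ = λ t c → inj₁ (constΓ W t c) ; winsInit = lower (ℕ.n≤1+n _) (winsInit W) }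
    where
    winsΓ′ : ∀ t → Wins GS H (Γ (addPair S s v w) t) g
    winsΓ′ t with em {t ≡ s}
    ... | yes refl = Wins-⊆ (λ { (inj₁ γ) → inj₁ γ ; (inj₂ (_ , e)) → inj₂ e }) win
    ... | no t≢s   = Wins-⊆ (λ { (inj₁ γ) → γ ; (inj₂ (t≡s , _)) → contradiction t≡s t≢s })
                            (lower (ℕ.n≤1+n _) (winsΓ W t))

  play-forth : ∀ {S p g} → cost ≤ p → Winning S (cost + p) (suc g) → ∀ c →
    ∃[ d ] ∃[ T ] (Winning T p g × S ≼ T × Represents T c d)
  play-forth {p = p} le W (inj₁ a) = play-base le (spendΓ (spend (s≤s (ℕ.m≤n+m p (r + rounds))) W)) a
  -- A root of a copy is a vertex of A and is answered in the first game.
  play-forth {p = p} le W (inj₂ (e , v)) with em {C.Root v}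
  ... | yes (j , v≈) =
    let d , T , W′ , S≼T , rep = play-base le (spendΓ (spend (s≤s (ℕ.m≤n+m p (r + rounds))) W)) (proj₁ e j)
    in d , T , W′ , S≼T , Represents-resp (copy-root v≈) D.∼-refl rep
  ... | no ¬v =
    let T , W′ , S≼T , _ , s , e≈ = ensureEdge {p = p} (spend (ℕ.+-monoˡ-≤ p (ℕ.m≤n+m rounds (suc r))) W) e
        w , win = forth (winsΓ W′ s) v
        -- The component of w selects which of the Rᵢ-edges answering e carries the reply.
        k , part = D.part-exists w
    in inj₂ (k , partEdge (matched T s) k , (w , part)) , addPair T s v w , addPair-winning W′ win
       , (λ x → addPair-≼ (S≼T x))
       , inEdge s k (w , part) (inj₂ (refl , G.≈-refl , H.≈-refl)) ¬v
           (return (𝒞.copy (A.≈-sym ∘ e≈) G.≈-refl)) D.∼-refl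

  play-back : ∀ {S p g} → cost ≤ p → Winning S (cost + p) (suc g) → ∀ d →
    ∃[ c ] ∃[ T ] (Winning T p g × S ≼ T × Represents T c d)
  play-back {S} {p} {g} le W (inj₁ (b , nonaux)) with back (lower (s≤s (ℕ.m≤n+m p (r + rounds))) (wins W)) b
  ... | x , w = case x refl
    where
    Answer : Set (lsuc ℓ)
    Answer = ∃[ c ] ∃[ T ] (Winning T p g × S ≼ T × Represents T c (inj₁ (b , nonaux)))

    withBase : ∀ a → inj₁ a AS.≈ x → Answer
    withBase a a≈x = inj₁ a , _ , withP-winning {S} inj₁ (spendΓ W) w , withP-≼ {S} inj₁
      , inBase (b , nonaux) (inj₂ (AS.≈-refl , B.≈-refl)) a≈x B.≈-refl C.∼-refl D.∼-refl

    case : ∀ z → z ≡ x → Answer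
    case (inj₁ a) refl = withBase a AS.≈-refl
    case (inj₂ (e , inj₁ j)) refl = withBase (proj₁ e j) (rootE e j)
    -- If the reply were auxiliary, answering the rest of its copy of `Gad` would exhibit b as the
    -- last vertex of an Rᵢ-edge of B.
    case (inj₂ (e , inj₂ i)) refl =
      let P′ , w′ , P⊆P′ , m , m≡ , rel = edge-forth {p = 0}
            (lower (ℕ.≤-trans (ℕ.≤-reflexive (ℕ.+-identityʳ rounds)) (ℕ.≤-trans (ℕ.m≤n+m rounds (suc r)) le)) w) e
          last≈ = to (eq-iff (atomic AS B w′) (rel (last (edgeVertex π i))) (P⊆P′ (inj₂ (AS.≈-refl , B.≈-refl))))
                     (edgeVertex-lastE e i)
      in contradiction (i , _ , isEdge m i , last≈) nonaux
  play-back {S} {p} le W (inj₂ (i , e′ , w)) with em {D.Root (proj₁ w)} | ensurePart {p = p} W e′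
  ... | no ¬w | T , W′ , S≼T , s , e′≈ =
    let v , win = back (winsΓ W′ s) (proj₁ w)
        W″ = addPair-winning {s = s} W′ win
        γ  = inj₂ (refl , G.≈-refl , H.≈-refl)
    in inj₂ (edge (matched T s) , v) , addPair T s v (proj₁ w) , W″ , (λ x → addPair-≼ (S≼T x))
       , inEdge s i w γ (nonroot⁻¹ W″ s γ ¬w) C.∼-refl (return (𝒟.copy (B.≈-sym ∘ e′≈) H.≈-refl))
  ... | yes root | T , W′ , S≼T , s , e′≈ with D.rootIn i (proj₂ w) root
  ...   | k , w≈ =
    let j   = lookup (X π i) k
        m   = matched T s
        b≈  = subst (λ u → init (proj₁ e′) k B.≈ answer m u) (edgeVertex-init π i k) (e′≈ (inject₁ k))
        b   = init (proj₁ e′) k , nonauxiliary (ℕ.≤-trans (ℕ.m≤m+n (suc r) rounds) le) (wins W′)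
                (answers W′ s (inj₁ j)) (rootE (edge m) j) b≈
    in inj₁ (proj₁ (edge m) j) , T , spendΓ W′ , S≼T
       , inBase b (answers W′ s (inj₁ j)) (rootE (edge m) j) b≈ C.∼-refl (return (𝒟.root k B.≈-refl w≈))

  -- Each round spends `cost` rounds of the first game and one round of the gadget games; a last
  -- `cost` remains for checking relations.
  play : ∀ q {S R} → Winning S (suc q * cost) q → (∀ {c d} → R c d → Represents S c d) →
         Wins (A ✶ G) (B ✶[ π ] H) R q
  play zero    W R⊆ = done (Atomic-⊆ R⊆ (represents-atomic W))
  play (suc q) W R⊆ = move (Atomic-⊆ R⊆ (represents-atomic W))
    (λ c → let d , T , W′ , S≼T , rep = play-forth (ℕ.m≤m+n cost (q * cost)) W c in
      d , play q W′ λ { (inj₁ x) → S≼T (R⊆ x) ; (inj₂ (p , q)) → Represents-resp (C.∼-sym p) (D.∼-sym q) rep })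
    (λ d → let c , T , W′ , S≼T , rep = play-back (ℕ.m≤m+n cost (q * cost)) W d in
      c , play q W′ λ { (inj₁ x) → S≼T (R⊆ x) ; (inj₂ (p , q)) → Represents-resp (C.∼-sym p) (D.∼-sym q) rep })

  composition : ∀ q → Wins AS B (constants AS B) (suc q * cost) → Wins GS H (constants GS H) q →
                Wins (A ✶ G) (B ✶[ π ] H) (constants (A ✶ G) (B ✶[ π ] H)) q
  composition q w w′ = play q {S = record { P = constants AS B ; Index = ⊥ ; matched = λ () ; Γ = λ () }}
    (record { wins = w ; answers = λ () ; distinct = λ () ; winsΓ = λ () ; constΓ = λ () ; winsInit = w′ })
    λ { (() , _) }

-- Existence of elementary limits

-- Every connective counts, unlike in `quantifierRank`, so formulas of bounded depth can be listed
-- by plain recursion.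
depth : {L : Language} {k n : ℕ} → Formula L k n → ℕ
depth (t ≐ u)    = 0
depth (atom S t) = 0
depth (¬̇ φ)      = suc (depth φ)
depth (φ ∧̇ ψ)    = suc (depth φ ⊔ depth ψ)
depth (∃̇ φ)      = suc (depth φ)

module _ {L : Language} (fin : FiniteLanguage L) {k : ℕ} where

  formulas : (d n : ℕ) → List (Formula L k n)
  formulas zero    n = []
  formulas (suc d) n = atomics fin n ++ map ¬̇_ (formulas d n) ++
    cartesianProductWith _∧̇_ (formulas d n) (formulas d n) ++ map ∃̇_ (formulas d (suc n))

  -- Argument vectors of atoms are listed up to pointwise equality, hence equivalence in place of
  -- equality.
  formulas-complete : ∀ {n} (φ : Formula L k n) {d} → depth φ < d →
    ∃[ ψ ] (ψ ∈ formulas d n × (∀ (M : Structure ℓ L k) ρ → Sat M φ ρ ⇔ Sat M ψ ρ))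
  formulas-complete (t ≐ u) (s≤s _) = _ , ∈-++⁺ˡ (∈-atomics-≐ fin t u) , λ M ρ → mk⇔ id id
  formulas-complete (atom S t) (s≤s _) with ∈-atomics-atom fin S t
  ... | u , t≗u , u∈ = _ , ∈-++⁺ˡ u∈ , λ M ρ →
    mk⇔ (Structure.rel-resp M S (λ i → subst (λ v → Structure._≈_ M (⟦_⟧ M (t i) ρ) (⟦_⟧ M v ρ)) (t≗u i) (Structure.≈-refl M)))
        (Structure.rel-resp M S (λ i → subst (λ v → Structure._≈_ M (⟦_⟧ M v ρ) (⟦_⟧ M (t i) ρ)) (t≗u i) (Structure.≈-refl M)))
  formulas-complete {n = n} (¬̇ φ) (s≤s lt) with formulas-complete φ lt
  ... | ψ , ψ∈ , e = _ , ∈-++⁺ʳ (atomics fin n) (∈-++⁺ˡ (∈-map⁺ ¬̇_ ψ∈)) , λ M ρ →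
    mk⇔ (_∘ from (e M ρ)) (_∘ to (e M ρ))
  formulas-complete {n = n} (φ ∧̇ φ′) {suc d} (s≤s lt)
    with formulas-complete φ (ℕ.≤-<-trans (ℕ.m≤m⊔n _ _) lt) | formulas-complete φ′ (ℕ.≤-<-trans (ℕ.m≤n⊔m (depth φ) _) lt)
  ... | ψ , ψ∈ , e | ψ′ , ψ′∈ , e′ =
    _ , ∈-++⁺ʳ (atomics fin n) (∈-++⁺ʳ (map ¬̇_ (formulas d n)) (∈-++⁺ˡ (∈-cartesianProductWith⁺ _∧̇_ ψ∈ ψ′∈))) , λ M ρ →
    mk⇔ (λ (s , u) → to (e M ρ) s , to (e′ M ρ) u) (λ (s , u) → from (e M ρ) s , from (e′ M ρ) u)
  formulas-complete {n = n} (∃̇ φ) {suc d} (s≤s lt) with formulas-complete φ lt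
  ... | ψ , ψ∈ , e = _ , ∈-++⁺ʳ (atomics fin n) (∈-++⁺ʳ (map ¬̇_ (formulas d n))
      (∈-++⁺ʳ (cartesianProductWith _∧̇_ (formulas d n) (formulas d n)) (∈-map⁺ ∃̇_ ψ∈))) , λ M ρ →
    mk⇔ (λ (x , s) → x , to (e M _) s) (λ (x , s) → x , from (e M _) s)

upperBound : {m : ℕ} (v : Vector ℕ m) → ∃[ b ] (∀ i → v i < b)
upperBound {zero}  v = 0 , λ ()
upperBound {suc m} v = let b , h = upperBound (v ∘ suc) in suc (v zero) ⊔ b , λ
  { zero → ℕ.m≤m⊔n _ b ; (suc i) → ℕ.≤-trans (h i) (ℕ.m≤n⊔m (suc (v zero)) b) }

-- A Henkin construction.  The elements of the limit are the indices of an
-- assignment of the variables x₀, x₁, … in M n, where n and the assignment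
-- range over a decreasing sequence of events each of which is met by
-- infinitely many n.
module HenkinLimit (em : ExcludedMiddle ℓ) {L : Language} (fin : FiniteLanguage L) {k : ℕ}
  (M : ℕ → Structure ℓ L k) (nonempty : ∀ n → Nonempty (M n)) where

  private
    module M n = Structure (M n)

    ≡⇒≈ : ∀ n {x y} → x ≡ y → M._≈_ n x y
    ≡⇒≈ n = Setoid.reflexive (M.universe n)

  Assignment : ℕ → Set ℓ
  Assignment n = ℕ → M.Carrier n

  Event : Set (lsuc ℓ)
  Event = ∀ n → Assignment n → Set ℓ

  Frequent : Event → Set ℓ
  Frequent E = ∀ N → ∃[ n ] (N ≤ n × ∃[ ρ ] E n ρ)

  -- Locality allows a variable with index at least `bound` to be overwritten without affecting the
  -- test.
  record Task : Set (lsuc ℓ) where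
    field
      test       : ∀ n → Assignment n → M.Carrier n → Set ℓ
      bound      : ℕ
      test-local : ∀ n {ρ τ} x → (∀ i → i < bound → ρ i ≡ τ i) → test n ρ x → test n τ x

    solvable : Event
    solvable n ρ = ∃[ x ] test n ρ x

  open Task

  record Stage : Set (lsuc ℓ) where
    field
      event       : Event
      fresh       : ℕ
      event-local : ∀ n {ρ τ} → (∀ i → i < fresh → ρ i ≡ τ i) → event n ρ → event n τ
      frequent    : Frequent event

  open Stage

  update : ∀ {n} → Assignment n → ℕ → M.Carrier n → Assignment n
  update ρ j x i with i ℕ.≟ j
  ... | yes _ = x
  ... | no  _ = ρ i

  update-same : ∀ {n} (ρ : Assignment n) j x → update ρ j x j ≡ x
  update-same ρ j x with j ℕ.≟ j
  ... | yes _   = refl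
  ... | no  j≢j = contradiction refl j≢j

  update-other : ∀ {n} (ρ : Assignment n) j x i → i < j → ρ i ≡ update ρ j x i
  update-other ρ j x i i<j with i ℕ.≟ j
  ... | yes refl = contradiction i<j (ℕ.n≮n i)
  ... | no  _    = refl

  -- If E without F never occurred beyond some N, then F would accompany every later occurrence of E
  -- and the conjunction would be frequent.
  frequent-split : ∀ {E F : Event} → Frequent E → ¬ Frequent (λ n ρ → E n ρ × F n ρ) → Frequent (λ n ρ → E n ρ × ¬ F n ρ)
  frequent-split {E} {F} freq ¬freq N with em {∃[ n ] (N ≤ n × ∃[ ρ ] (E n ρ × ¬ F n ρ))}
  ... | yes found = found
  ... | no ¬found = contradiction often ¬freq
    where
    often : Frequent (λ n ρ → E n ρ × F n ρ)
    often N′ with freq (N ⊔ N′)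
    ... | n , le , ρ , e with em {F n ρ}
    ...   | yes f = n , ℕ.m⊔n≤o⇒n≤o N N′ le , ρ , e , f
    ...   | no ¬f = contradiction (n , ℕ.m⊔n≤o⇒m≤o N N′ le , ρ , e , ¬f) ¬found

  solve : (S : Stage) (T : Task) → Frequent (λ n ρ → event S n ρ × solvable T n ρ) → Stage
  solve S T freq = record
    { event       = λ n ρ → event S n ρ × test T n ρ (ρ j)
    ; fresh       = suc j
    ; event-local = λ n {ρ} {τ} eq (e , t) →
        event-local S n (λ i i< → eq i (ℕ.m≤n⇒m≤1+n (ℕ.≤-trans i< fresh≤))) e ,
        subst (test T n τ) (eq j ℕ.≤-refl) (test-local T n (ρ j) (λ i i< → eq i (ℕ.m≤n⇒m≤1+n (ℕ.≤-trans i< bound≤))) t)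
    ; frequent    = λ N → let n , le , ρ , e , x , t = freq N in n , le , update ρ j x ,
        event-local S n (λ i i< → update-other ρ j x i (ℕ.≤-trans i< fresh≤)) e ,
        subst (test T n _) (sym (update-same ρ j x)) (test-local T n x (λ i i< → update-other ρ j x i (ℕ.≤-trans i< bound≤)) t) }
    where
    -- A variable on which neither the event nor the test depends; it stores the solution.
    j = fresh S ⊔ bound T
    fresh≤ : fresh S ≤ j
    fresh≤ = ℕ.m≤m⊔n _ _
    bound≤ : bound T ≤ j
    bound≤ = ℕ.m≤n⊔m (fresh S) _

  refute : (S : Stage) (T : Task) → ¬ Frequent (λ n ρ → event S n ρ × solvable T n ρ) → Stage
  refute S T ¬freq = record
    { event       = λ n ρ → event S n ρ × ¬ solvable T n ρ
    ; fresh       = fresh S ⊔ bound T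
    ; event-local = λ n eq (e , ¬t) →
        event-local S n (λ i i< → eq i (ℕ.≤-trans i< (ℕ.m≤m⊔n _ _))) e ,
        λ (x , t) → ¬t (x , test-local T n x (λ i i< → sym (eq i (ℕ.≤-trans i< (ℕ.m≤n⊔m (fresh S) _)))) t)
    ; frequent    = frequent-split (frequent S) ¬freq }

  perform : Stage → Task → Stage
  perform S T with em {Frequent (λ n ρ → event S n ρ × solvable T n ρ)}
  ... | yes freq = solve S T freq
  ... | no ¬freq = refute S T ¬freq

  perform-shrinks : ∀ S T {n ρ} → event (perform S T) n ρ → event S n ρ
  perform-shrinks S T e with em {Frequent (λ n ρ → event S n ρ × solvable T n ρ)}
  ... | yes _ = proj₁ e
  ... | no  _ = proj₁ e

  Decides : Stage → Task → Set ℓ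
  Decides S T = (∃[ j ] (∀ n ρ → event S n ρ → test T n ρ (ρ j))) ⊎ (∀ n ρ → event S n ρ → ¬ solvable T n ρ)

  perform-decides : ∀ S T → Decides (perform S T) T
  perform-decides S T with em {Frequent (λ n ρ → event S n ρ × solvable T n ρ)}
  ... | yes _ = inj₁ (_ , λ n ρ → proj₂)
  ... | no  _ = inj₂ (λ n ρ → proj₂)

  performs-shrink : ∀ S Ts {n ρ} → event (foldl perform S Ts) n ρ → event S n ρ
  performs-shrink S []       e = e
  performs-shrink S (T ∷ Ts) e = perform-shrinks S T (performs-shrink (perform S T) Ts e)

  performs-decide : ∀ S Ts {T} → T ∈ Ts → Decides (foldl perform S Ts) T
  performs-decide S (T ∷ Ts) (here refl) with perform-decides S T
  ... | inj₁ (j , h) = inj₁ (j , λ n ρ e → h n ρ (performs-shrink (perform S T) Ts e))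
  ... | inj₂ h       = inj₂ (λ n ρ e → h n ρ (performs-shrink (perform S T) Ts e))
  performs-decide S (T ∷ Ts) (there T∈) = performs-decide (perform S T) Ts T∈

  -- Any element solves this task once φ holds, so by nonemptiness `solvable` means truth of φ.
  decideTask : ∀ {m} → Formula L k m → Vector ℕ m → Task
  decideTask φ v = record
    { test = λ n ρ _ → Sat (M n) φ (ρ ∘ v)
    ; bound = proj₁ (upperBound v)
    ; test-local = λ n x eq → Sat-resp (M n) φ (λ i → ≡⇒≈ n (eq (v i) (proj₂ (upperBound v) i))) }

  witnessTask : ∀ {m} → Formula L k (suc m) → Vector ℕ m → Task
  witnessTask φ v = record
    { test = λ n ρ x → Sat (M n) φ (x ∷ᵛ ρ ∘ v)
    ; bound = proj₁ (upperBound v)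
    ; test-local = λ n x eq → Sat-resp (M n) φ (∷-resp (M n) x (λ i → ≡⇒≈ n (eq (v i) (proj₂ (upperBound v) i)))) }

  tasksFor : ℕ → ℕ → List Task
  tasksFor d m =
    cartesianProductWith decideTask  (formulas fin d m)       (vectors (upTo d) m) ++
    cartesianProductWith witnessTask (formulas fin d (suc m)) (vectors (upTo d) m)

  -- Finitely many tasks for each d, while every formula with every vector of variables is reached,
  -- up to equivalence, for large d.
  tasks : ℕ → List Task
  tasks d = concatMap (tasksFor d) (upTo d)

  stage : ℕ → Stage
  stage zero    = record
    { event = λ _ _ → ⊤ ; fresh = 0 ; event-local = λ _ _ _ → _
    ; frequent = λ N → N , ℕ.≤-refl , (λ _ → nonempty N) , _ }
  stage (suc d) = foldl perform (stage d) (tasks d)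

  stage-shrinks : ∀ {d d′ n ρ} → d ≤ d′ → event (stage d′) n ρ → event (stage d) n ρ
  stage-shrinks {zero}  {zero}   d≤ e = e
  stage-shrinks {d} {suc d′} d≤ e with ℕ.m≤n⇒m<n∨m≡n d≤
  ... | inj₁ (s≤s d≤d′) = stage-shrinks d≤d′ (performs-shrink (stage d′) (tasks d′) e)
  ... | inj₂ refl       = e

  -- The filter generated by the stages. It is proper by `forced-consistent` and decides all
  -- first-order events by `decide`.
  Forced : Event → Set ℓ
  Forced E = ∃[ d ] (∀ n ρ → event (stage d) n ρ → E n ρ)

  forced-map : ∀ {E F : Event} → (∀ n ρ → E n ρ → F n ρ) → Forced E → Forced F
  forced-map f (d , h) = d , λ n ρ e → f n ρ (h n ρ e)

  forced-× : ∀ {E F : Event} → Forced E → Forced F → Forced (λ n ρ → E n ρ × F n ρ)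
  forced-× (d , h) (d′ , h′) = d ⊔ d′ , λ n ρ e →
    h n ρ (stage-shrinks (ℕ.m≤m⊔n d d′) e) , h′ n ρ (stage-shrinks (ℕ.m≤n⊔m d d′) e)

  forced-∀ : ∀ m {E : Fin m → Event} → (∀ i → Forced (E i)) → Forced (λ n ρ → ∀ i → E i n ρ)
  forced-∀ zero    h = 0 , λ _ _ _ ()
  forced-∀ (suc m) h = forced-map (λ { n ρ (e , es) zero → e ; n ρ (e , es) (suc i) → es i })
    (forced-× (h zero) (forced-∀ m (h ∘ suc)))

  forced-consistent : ∀ {E : Event} → Forced E → ¬ Forced (λ n ρ → ¬ E n ρ)
  forced-consistent f g =
    let d , h = forced-× f g
        n , _ , ρ , e = frequent (stage d) 0
        p , ¬p = h n ρ e
    in ¬p p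

  module _ {m : ℕ} (v : Vector ℕ m) where

    private
      listed : ∀ {n} (φ : Formula L k n) →
        ∃[ d ] (m < d × depth φ < d × ∃[ u ] (u ∈ vectors (upTo d) m × v ≗ u))
      listed φ =
        let b , v<b = upperBound v
            d   = suc (m ⊔ depth φ ⊔ b)
            u , u∈ , v≗u = vectors-complete {xs = upTo d} v
              (λ i → ∈-upTo⁺ (ℕ.<-≤-trans (v<b i) (ℕ.m≤n⇒m≤1+n (ℕ.m≤n⊔m (m ⊔ depth φ) b))))
        in d , s≤s (ℕ.≤-trans (ℕ.m≤m⊔n m _) (ℕ.m≤m⊔n (m ⊔ depth φ) b))
             , s≤s (ℕ.≤-trans (ℕ.m≤n⊔m m _) (ℕ.m≤m⊔n (m ⊔ depth φ) b)) , u , u∈ , v≗u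

    decide : (φ : Formula L k m) → Forced (λ n ρ → Sat (M n) φ (ρ ∘ v)) ⊎ Forced (λ n ρ → ¬ Sat (M n) φ (ρ ∘ v))
    decide φ with listed φ
    ... | d , m<d , φ<d , u , u∈ , v≗u with formulas-complete fin φ φ<d
    ...   | ψ , ψ∈ , e with performs-decide (stage d) (tasks d) {decideTask ψ u}
                         (∈-concatMap⁺ (tasksFor d) (lose (∈-upTo⁺ m<d) (∈-++⁺ˡ (∈-cartesianProductWith⁺ decideTask ψ∈ u∈))))
    ...     | inj₁ (j , h) = inj₁ (suc d , λ n ρ ev →
      from (e (M n) _) (Sat-resp (M n) ψ (λ i → ≡⇒≈ n (cong ρ (sym (v≗u i)))) (h n ρ ev)))
    ...     | inj₂ h = inj₂ (suc d , λ n ρ ev s → h n ρ ev (nonempty n ,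
      Sat-resp (M n) ψ (λ i → ≡⇒≈ n (cong ρ (v≗u i))) (to (e (M n) _) s)))

    witness : (φ : Formula L k (suc m)) → Forced (λ n ρ → Sat (M n) (∃̇ φ) (ρ ∘ v)) →
              ∃[ j ] Forced (λ n ρ → Sat (M n) φ (ρ j ∷ᵛ ρ ∘ v))
    witness φ forced with listed φ
    ... | d , m<d , φ<d , u , u∈ , v≗u with formulas-complete fin φ φ<d
    ...   | ψ , ψ∈ , e with performs-decide (stage d) (tasks d) {witnessTask ψ u}
                         (∈-concatMap⁺ (tasksFor d) (lose (∈-upTo⁺ m<d)
                           (∈-++⁺ʳ (cartesianProductWith decideTask (formulas fin d m) (vectors (upTo d) m))
                             (∈-cartesianProductWith⁺ witnessTask ψ∈ u∈))))
    ...     | inj₁ (j , h) = j , suc d , λ n ρ ev →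
      from (e (M n) _) (Sat-resp (M n) ψ (∷-resp (M n) (ρ j) (λ i → ≡⇒≈ n (cong ρ (sym (v≗u i))))) (h n ρ ev))
    ...     | inj₂ h = contradiction (suc d , λ n ρ ev (x , s) → h n ρ ev (x ,
      Sat-resp (M n) ψ (∷-resp (M n) x (λ i → ≡⇒≈ n (cong ρ (v≗u i)))) (to (e (M n) _) s)))
      (forced-consistent forced)

  constant : ∀ c → ∃[ j ] Forced (λ n ρ → M._≈_ n (ρ j) (M.const n c))
  constant c = witness {0} (λ ()) (var zero ≐ cst c) (0 , λ n ρ _ → M.const n c , M.≈-refl n)

  limit : Structure ℓ L k
  limit .Structure.universe = record
    { Carrier = Lift ℓ ℕ
    ; _≈_ = λ (lift i) (lift j) → Forced (λ n ρ → M._≈_ n (ρ i) (ρ j))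
    ; isEquivalence = record
      { refl  = 0 , λ n ρ _ → M.≈-refl n
      ; sym   = forced-map (λ n ρ → M.≈-sym n)
      ; trans = λ p q → forced-map (λ n ρ (p , q) → M.≈-trans n p q) (forced-× p q) } }
  limit .Structure.rel S t = Forced (λ n ρ → M.rel n S (ρ ∘ Lift.lower ∘ t))
  limit .Structure.rel-resp S t≈u St =
    forced-map (λ n ρ (eq , s) → M.rel-resp n S eq s) (forced-× (forced-∀ _ t≈u) St)
  limit .Structure.const c = lift (proj₁ (constant c))

  private
    module N = Structure limit

  term-forced : ∀ {m} (t : Term k m) (v : Vector N.Carrier m) →
    Forced (λ n ρ → M._≈_ n (ρ (Lift.lower (⟦_⟧ limit t v))) (⟦_⟧ (M n) t (ρ ∘ Lift.lower ∘ v)))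
  term-forced (var i) v = 0 , λ n ρ _ → M.≈-refl n
  term-forced (cst c) v = proj₂ (constant c)

  mutual
    -- The truth lemma. Negation exchanges the two directions, hence the mutual recursion; `decide`
    -- and `witness` settle `¬̇_` and `∃̇_`.
    truth⇒ : ∀ {m} (φ : Formula L k m) v → Sat limit φ v → Forced (λ n ρ → Sat (M n) φ (ρ ∘ Lift.lower ∘ v))
    truth⇒ (t ≐ u) v s = forced-map (λ n ρ (s , p , q) → M.≈-trans n (M.≈-sym n p) (M.≈-trans n s q))
      (forced-× s (forced-× (term-forced t v) (term-forced u v)))
    truth⇒ (atom S t) v s = forced-map (λ n ρ (eq , s) → M.rel-resp n S eq s)
      (forced-× (forced-∀ _ (λ i → term-forced (t i) v)) s)
    truth⇒ (¬̇ φ) v s with decide (Lift.lower ∘ v) φ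
    ... | inj₁ f = contradiction (truth⇐ φ v f) s
    ... | inj₂ f = f
    truth⇒ (φ ∧̇ ψ) v (s , u) = forced-× (truth⇒ φ v s) (truth⇒ ψ v u)
    truth⇒ (∃̇ φ) v (x , s) = forced-map
      (λ n ρ s → ρ (Lift.lower x) , Sat-resp (M n) φ (λ { zero → M.≈-refl n ; (suc i) → M.≈-refl n }) s)
      (truth⇒ φ (x ∷ᵛ v) s)

    truth⇐ : ∀ {m} (φ : Formula L k m) v → Forced (λ n ρ → Sat (M n) φ (ρ ∘ Lift.lower ∘ v)) → Sat limit φ v
    truth⇐ (t ≐ u) v f = forced-map (λ n ρ (s , p , q) → M.≈-trans n p (M.≈-trans n s (M.≈-sym n q)))
      (forced-× f (forced-× (term-forced t v) (term-forced u v)))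
    truth⇐ (atom S t) v f = forced-map (λ n ρ (eq , s) → M.rel-resp n S (λ i → M.≈-sym n (eq i)) s)
      (forced-× (forced-∀ _ (λ i → term-forced (t i) v)) f)
    truth⇐ (¬̇ φ) v f s = forced-consistent (truth⇒ φ v s) f
    truth⇐ (φ ∧̇ ψ) v f = truth⇐ φ v (forced-map (λ _ _ → proj₁) f) , truth⇐ ψ v (forced-map (λ _ _ → proj₂) f)
    truth⇐ (∃̇ φ) v f = let j , g = witness (Lift.lower ∘ v) φ f in
      lift j , truth⇐ φ (lift j ∷ᵛ v)
        (forced-map (λ n ρ → Sat-resp (M n) φ (λ { zero → M.≈-refl n ; (suc i) → M.≈-refl n })) g)

  -- Each stage occurs at arbitrarily large n, so what it forces cannot contradict what holds
  -- eventually.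
  limit-isLimit : ElementarilyConvergent M → IsElementaryLimit limit M
  limit-isLimit conv φ = mk⇔ eventually satisfied
    where
    eventually : limit ⊨ φ → Eventually (λ n → M n ⊨ φ)
    eventually s with conv φ | truth⇒ φ _ s
    ... | inj₁ ev      | _ = ev
    ... | inj₂ (N , h) | d , f =
      let n , N≤n , ρ , e = frequent (stage d) N
      in contradiction (Sat-resp (M n) φ (λ ()) (f n ρ e)) (h n N≤n)

    satisfied : Eventually (λ n → M n ⊨ φ) → limit ⊨ φ
    satisfied (N , h) with decide (λ ()) φ
    ... | inj₁ f = truth⇐ φ _ (forced-map (λ n ρ → Sat-resp (M n) φ (λ ())) f)
    ... | inj₂ (d , f) =
      let n , N≤n , ρ , e = frequent (stage d) N
      in contradiction (Sat-resp (M n) φ (λ ()) (h n N≤n)) (f n ρ e)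

-- Convergence of the glued structures and their limit

fragmentLanguage-finite : {L : Language} {r : ℕ} {σ : Rel (Fin r) s} (π : Classes σ) →
                          FiniteLanguage L → FiniteLanguage (fragmentLanguage π L)
fragmentLanguage-finite π (n , e) = n + suc (Classes.count π) , ↔-sym +↔⊎ ↔-∘ (e ⊎-↔ ↔-id _)

replacement-isLimit : ExcludedMiddle ℓ → {L : Language} → FiniteLanguage L → PositiveArities L → {r : ℕ}
  (A : ℕ → BaseStructure ℓ L r) (G : ℕ → Gadget ℓ L r) (π : Classes (FiniteLimitDistance G)) →
  (B : Structure ℓ (fragmentLanguage π L) 0) → IsElementaryLimit B (λ n → fragment π (A n)) →
  (H : Structure ℓ L r) → IsElementaryLimit H (λ n → Gadget.structure (G n)) →
  IsElementaryLimit (B ✶[ π ] H) (λ n → A n ✶ G n)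
replacement-isLimit em {L} fin positive A G π B limB H limH φ = mk⇔
  (λ s → eventually-map (λ n e → from e s) agreement)
  -- A single index where both hold suffices; the common threshold is one.
  (λ sat → let N , h = eventually-× sat agreement ; s , e = h N ℕ.≤-refl in to e s)
  where
  module H = Structure H

  roots-distinct : ∀ i j → H.const i H.≈ H.const j → i ≡ j
  roots-distinct i j e =
    -- Equality of constants is atomic, so zero rounds suffice.
    let N , h = eventually-wins em fin limH 0
        named c = c , Gadget.≈-refl (G N) , H.≈-refl
    in Gadget.roots-distinct (G N) i j (from (eq-iff (atomic _ _ (h N ℕ.≤-refl)) (named i) (named j)) e)

  separated : ∀ i j → Connected H (H.const i) (H.const j) → Classes.class π i ≡ Classes.class π j
  separated i j c = from (Classes.class-σ π i j) (connected⇒finiteDistance em fin G H limH i j c)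

  module Comp n = Composition em positive π (A n) (G n) B H roots-distinct separated

  agreement : Eventually (λ n → A n ✶ G n ⊨ φ ⇔ (B ✶[ π ] H) ⊨ φ)
  agreement = eventually-map
    (λ n (w , w′) → wins⇒Sat φ ℕ.≤-refl (Comp.composition n (quantifierRank φ) w w′) (λ ()) (λ ()))
    -- `cost` depends only on r and the number of classes, so its value at index 0 serves all n.
    (eventually-× (eventually-wins em (fragmentLanguage-finite {L = L} π fin) limB (suc (quantifierRank φ) * Comp.cost 0))
                  (eventually-wins em fin limH (quantifierRank φ)))

limit⇒convergent : ExcludedMiddle ℓ → {L : Language} {k : ℕ} {N : Structure ℓ L k} {M : ℕ → Structure ℓ L k} →
                   IsElementaryLimit N M → ElementarilyConvergent M
limit⇒convergent em {N = N} lim φ with em {N ⊨ φ}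
... | yes s = inj₁ (to (lim φ) s)
... | no ¬s = inj₂ (to (lim (¬̇ φ)) ¬s)

theorem3p5 : {ℓ : Level} → ExcludedMiddle ℓ →
    (L : Language) → FiniteLanguage L → PositiveArities L →
    (r : ℕ) → 1 ≤ r →
    (A : ℕ → BaseStructure ℓ L r) → (∀ n → Nonempty (A n)) →
    (G : ℕ → Gadget ℓ L r) → ElementarilyConvergent (λ n → Gadget.structure (G n)) →
    (π : Classes (FiniteLimitDistance G)) →
    ElementarilyConvergent (λ n → fragment π (A n)) →
    ElementarilyConvergent (λ n → A n ✶ G n)
    × ((B : Structure ℓ (fragmentLanguage π L) 0) → IsElementaryLimit B (λ n → fragment π (A n)) →
    (H : Structure ℓ L r) → IsElementaryLimit H (λ n → Gadget.structure (G n)) →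
    ∃ (λ (M : Structure ℓ L 0) → IsElementaryLimit M (λ n → A n ✶ G n))
    × ((M : Structure ℓ L 0) → IsElementaryLimit M (λ n → A n ✶ G n) →
    M ≡ᵉ (B ✶[ π ] H)))
theorem3p5 em L fin positive (suc r) 1≤r A nonempty G convG π convA =
  limit⇒convergent em (isLimit LimA.limit (LimA.limit-isLimit convA) LimG.limit (LimG.limit-isLimit convG)) ,
  λ B limB H limH → (B ✶[ π ] H , isLimit B limB H limH) ,
    λ M limM φ → ⇔-sym (isLimit B limB H limH φ) ⇔-∘ limM φ
  where
  module LimA = HenkinLimit em (fragmentLanguage-finite {L = L} π fin) (λ n → fragment π (A n)) (λ n → inj₁ (nonempty n))
  -- The first root, present as r is positive, shows that the gadgets are nonempty.
  module LimG = HenkinLimit em fin (λ n → Gadget.structure (G n)) (λ n → Gadget.const (G n) zero)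

  isLimit = replacement-isLimit em fin positive A G π
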